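{- Let $k$ be a fixed positive integer, and let $H$ and $V$ be finite sets of words over the alphabet $\{0,1\}$. For each positive integer $n$, let $b_{H,V,k}(n)$ be the number of $2k \times 2n$ matrices with entries in $\{0,1\}$ such that every row contains exactly $n$ ones and every column contains exactly $k$ ones, every row avoids every pattern in $H$, and every column avoids every pattern in $V$. Then there exist a positive integer $L$ and polynomials $p_0(n), \dots, p_L(n)$ in $n$, with $p_L(n) \neq 0$, such that $$\sum_{i=0}^{L} p_i(n)\, b_{H,V,k}(n+i) = 0$$ for all positive integers $n$.
   Context: A word $w_1 \dots w_n$ contains the word (pattern) $p_1 \dots p_r$ if there is an index $i$ with $w_i = p_1, \dots, w_{i+r-1} = p_r$ (consecutive occurrence); it avoids the pattern otherwise. A row or column of a matrix is read as a word over $\{0,1\}$. -}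

module Defs where

open import Data.Bool using (Bool; true; false; if_then_else_)
open import Data.Nat using (ℕ; zero; suc; _+_; _*_)
open import Data.Integer as ℤ using (ℤ)
open import Data.List as List using (List; []; _∷_; length; filter; concatMap; map; foldr)
open import Data.List.Relation.Unary.All using (All)
open import Data.List.Relation.Unary.Any using (Any)
open import Data.Vec as Vec using (Vec; []; _∷_; toList; transpose)
open import Data.Product using (Σ; _×_; _,_)
open import Relation.Binary.PropositionalEquality using (_≡_)
open import Relation.Nullary using (¬_)

-- Words over the alphabet {0,1}: lists of booleans (false = 0, true = 1).
Word : Set
Word = List Bool

data IsPrefix : Word → Word → Set where
  []-prefix : ∀ {w} → IsPrefix [] w
  ∷-prefix  : ∀ {a u w} → IsPrefix u w → IsPrefix (a ∷ u) (a ∷ w)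

data Contains : Word → Word → Set where
  here  : ∀ {p w} → IsPrefix p w → Contains w p
  there : ∀ {a p w} → Contains w p → Contains (a ∷ w) p

Avoids : Word → Word → Set
Avoids w p = ¬ Contains w p

ones : Word → ℕ
ones [] = 0
ones (true ∷ w) = suc (ones w)
ones (false ∷ w) = ones w

Matrix : ℕ → ℕ → Set
Matrix m c = Vec (Vec Bool c) m

rows : ∀ {m c} → Matrix m c → List Word
rows M = toList (Vec.map toList M)

cols : ∀ {m c} → Matrix m c → List Word
cols M = toList (Vec.map toList (transpose M))

Good : (H V : List Word) (k n : ℕ) → Matrix (2 * k) (2 * n) → Set
Good H V k n M =
  All (λ r → ones r ≡ n) (rows M) ×
  All (λ c → ones c ≡ k) (cols M) ×
  All (λ r → All (Avoids r) H) (rows M) ×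
  All (λ c → All (Avoids c) V) (cols M)

-- Finiteness/counting: b_{H,V,k}(n) is the cardinality of the set of good
-- matrices, expressed as: a duplicate-free list enumerating exactly the good
-- matrices has length b.  We state it as a relation to avoid fixing an
-- enumeration strategy.
open import Data.List.Relation.Unary.Unique.Propositional using (Unique)
open import Data.List.Membership.Propositional using (_∈_)

IsCount : ∀ {A : Set} → (A → Set) → ℕ → Set
IsCount {A} P b = Σ (List A) λ xs →
  Unique xs × (∀ x → P x → x ∈ xs) × All P xs × length xs ≡ b

-- Polynomials in one variable with integer coefficients, as coefficient
-- lists (constant term first).
Poly : Set
Poly = List ℤ

evalPoly : Poly → ℤ → ℤ
evalPoly [] x = ℤ.0ℤ
evalPoly (a ∷ as) x = a ℤ.+ x ℤ.* evalPoly as x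

NonZeroPoly : Poly → Set
NonZeroPoly p = ¬ All (_≡ ℤ.0ℤ) p

recSum : (L : ℕ) → (ℕ → Poly) → (ℕ → ℕ) → ℕ → ℤ
recSum zero p b n = evalPoly (p 0) (ℤ.+ n) ℤ.* ℤ.+ (b n)
recSum (suc L) p b n =
  recSum L p b n ℤ.+ evalPoly (p (suc L)) (ℤ.+ n) ℤ.* ℤ.+ (b (n + suc L))

module Submission where

-- Reading a matrix column by column, a finite automaton checks the conditions
-- on the rows.  Let F(N; γ) be the number of accepted words of N admissible
-- columns whose row s has γ_s more ones than zeros, so that b(n) = F(2n; 0).
-- Gaussian elimination over the states shows that the generating function of F
-- is P / Q with Laurent polynomials P and Q.  The D^(m+2) functions
--   (N - 2D)^j ∏_s γ_s (γ_s + 1) … (γ_s + c_s - 1) F(N - 2i; γ + c)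
-- with all c_s, i, j < D have the form P′ / Q^e with a common exponent e = O(D)
-- and P′ supported in a box of O(D^(m+1)) points, so for large D they are
-- linearly dependent.  If c is minimal among the exponents occurring in the
-- dependency, setting γ = -c kills the terms of all others and leaves a
-- recurrence in N for F(N; 0).

open import Defs
open import Data.Bool as Bool using (Bool; true; false; if_then_else_; _∧_; _∨_; not)
import Data.Bool.Properties as Bool
open import Data.Empty using (⊥-elim)
open import Data.Integer as ℤ using (ℤ; 0ℤ; 1ℤ; _+_; _*_; -_; ∣_∣)
import Data.Integer.Properties as ℤ
open import Data.Integer.Tactic.RingSolver using (solve-∀)
open import Data.List using (List; []; _∷_; _++_; length; upTo; map; filter; foldl; cartesianProductWith)
open import Data.List.Membership.Propositional using (_∈_; find; lose)
open import Data.List.Membership.Propositional.Properties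
  using (∈-∃++; ∈-++⁺ˡ; ∈-++⁺ʳ; ∈-++⁻; ∈-map⁺; ∈-map⁻; ∈-filter⁺; ∈-filter⁻; ∈-upTo⁺; ∈-upTo⁻;
         ∈-cartesianProductWith⁺; ∈-cartesianProductWith⁻)
open import Data.List.Membership.Propositional.Properties.WithK using (unique∧set⇒bag)
open import Data.List.Properties using (length-++; length-++-sucʳ; length-map; length-upTo; map-applyUpTo)
open import Data.List.Relation.Binary.BagAndSetEquality using (∼bag⇒↭)
open import Data.List.Relation.Binary.Permutation.Propositional.Properties using (↭-length)
open import Data.List.Relation.Unary.All as All using (All; []; _∷_; all?)
open import Data.List.Relation.Unary.All.Properties using (¬All⇒Any¬)
open import Data.List.Relation.Unary.AllPairs using ([]; _∷_)
open import Data.List.Relation.Unary.Any using (here; there; any?)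
open import Data.List.Relation.Unary.Unique.Propositional using (Unique)
open import Data.List.Relation.Unary.Unique.Propositional.Properties using (cartesianProductWith⁺; filter⁺; map⁺; upTo⁺)
open import Data.Nat as ℕ using (ℕ; zero; suc)
import Data.Nat.Properties as ℕ
import Data.Nat.Tactic.RingSolver as ℕ-Solver
open import Data.Product as Product using (Σ; ∃; _×_; _,_; proj₁; proj₂)
open import Data.Product.Function.NonDependent.Propositional using (_×-⇔_)
open import Data.Product.Properties using (,-injective) renaming (≡-dec to ×-≡-dec)
open import Data.Sum using (inj₁; inj₂; [_,_]′)
open import Data.Unit using (⊤; tt)
open import Data.Vec as Vec using (Vec; []; _∷_; head; tail; zipWith; replicate; toList; transpose; _⊛_)
import Data.Vec.Properties as Vec
import Data.Vec.Relation.Unary.All as V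
open import Function using (_∘_; _⇔_; mk⇔; Equivalence)
open import Function.Properties.Equivalence using () renaming (trans to ⇔-trans; refl to ⇔-refl; sym to ⇔-sym)
open import Relation.Binary.Definitions using (DecidableEquality; tri<; tri≈; tri>)
open import Relation.Binary.PropositionalEquality
open import Relation.Nullary using (¬_; Dec; yes; no; does; contradiction; _×-dec_; ¬?)
open import Relation.Nullary.Decidable using (map′)
open import Relation.Unary using (Decidable)

open Equivalence using (to; from)

-- The exponents `c`, `i`, `j` give `m + 2` free parameters, while the supports lie in dimension
-- `m + 1`; without the powers of `N - 2D` the two sides would tie. Rational functions are never
-- formed. A denominator is an operator on families of coefficients, and cancelling it means that it
-- acts injectively on families that vanish at negative lengths. The main obstacle is the passage to
-- balance zero: with arbitrary polynomial weights in `γ`, a nontrivial relation could collapse to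
-- `0 = 0` there. Rising factorials tied to the shift `c` are the coefficient form of derivatives,
-- and for these one block of coefficients can always be isolated. The shifts are even because only
-- the lengths `2n` matter.

variable
  A B E : Set
  m n : ℕ

-- Finite sums and enumerations of vectors

interchange : ∀ a b c d → (a + b) + (c + d) ≡ (a + c) + (b + d)
interchange = solve-∀

∑ : List A → (A → ℤ) → ℤ
∑ [] g = 0ℤ
∑ (x ∷ xs) g = g x + ∑ xs g

∑-cong : (xs : List A) {g h : A → ℤ} → (∀ x → x ∈ xs → g x ≡ h x) → ∑ xs g ≡ ∑ xs h
∑-cong [] e = refl
∑-cong (x ∷ xs) e = cong₂ _+_ (e x (here refl)) (∑-cong xs (λ y y∈ → e y (there y∈)))

∑-zero : (xs : List A) {g : A → ℤ} → (∀ x → x ∈ xs → g x ≡ 0ℤ) → ∑ xs g ≡ 0ℤ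
∑-zero [] e = refl
∑-zero (x ∷ xs) e = cong₂ _+_ (e x (here refl)) (∑-zero xs (λ y y∈ → e y (there y∈)))

∑-*ˡ : (c : ℤ) (xs : List A) (g : A → ℤ) → c * ∑ xs g ≡ ∑ xs (λ x → c * g x)
∑-*ˡ c [] g = ℤ.*-zeroʳ c
∑-*ˡ c (x ∷ xs) g = trans (ℤ.*-distribˡ-+ c (g x) (∑ xs g)) (cong (c * g x +_) (∑-*ˡ c xs g))

∑-+ : (xs : List A) (g h : A → ℤ) → ∑ xs (λ x → g x + h x) ≡ ∑ xs g + ∑ xs h
∑-+ [] g h = refl
∑-+ (x ∷ xs) g h = trans (cong (g x + h x +_) (∑-+ xs g h)) (interchange (g x) (h x) (∑ xs g) (∑ xs h))

∑-++ : (xs ys : List A) (g : A → ℤ) → ∑ (xs ++ ys) g ≡ ∑ xs g + ∑ ys g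
∑-++ [] ys g = sym (ℤ.+-identityˡ (∑ ys g))
∑-++ (x ∷ xs) ys g = trans (cong (g x +_) (∑-++ xs ys g)) (sym (ℤ.+-assoc (g x) (∑ xs g) (∑ ys g)))

∑-map : (f : A → B) (xs : List A) (g : B → ℤ) → ∑ (map f xs) g ≡ ∑ xs (λ x → g (f x))
∑-map f [] g = refl
∑-map f (x ∷ xs) g = cong (g (f x) +_) (∑-map f xs g)

∑-product : (f : A → B → E) (xs : List A) (ys : List B) (g : E → ℤ) →
  ∑ (cartesianProductWith f xs ys) g ≡ ∑ xs (λ x → ∑ ys (λ y → g (f x y)))
∑-product f [] ys g = refl
∑-product f (x ∷ xs) ys g =
  trans (∑-++ (map (f x) ys) (cartesianProductWith f xs ys) g)
        (cong₂ _+_ (∑-map (f x) ys g) (∑-product f xs ys g))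

length-product : (f : A → B → E) (xs : List A) (ys : List B) →
  length (cartesianProductWith f xs ys) ≡ length xs ℕ.* length ys
length-product f [] ys = refl
length-product f (x ∷ xs) ys =
  trans (length-++ (map (f x) ys)) (cong₂ ℕ._+_ (length-map (f x) ys) (length-product f xs ys))

vecs : List A → ∀ n → List (Vec A n)
vecs xs zero = [] ∷ []
vecs xs (suc n) = cartesianProductWith _∷_ xs (vecs xs n)

length-vecs : (xs : List A) (n : ℕ) → length (vecs xs n) ≡ length xs ℕ.^ n
length-vecs xs zero = refl
length-vecs xs (suc n) = trans (length-product _∷_ xs (vecs xs n)) (cong (length xs ℕ.*_) (length-vecs xs n))

∈-vecs : {xs : List A} {v : Vec A n} → V.All (_∈ xs) v → v ∈ vecs xs n
∈-vecs V.[] = here refl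
∈-vecs (p V.∷ ps) = ∈-cartesianProductWith⁺ _∷_ p (∈-vecs ps)

vecs-unique : {xs : List A} → Unique xs → ∀ n → Unique (vecs xs n)
vecs-unique u zero = [] ∷ []
vecs-unique u (suc n) = cartesianProductWith⁺ _∷_ Vec.∷-injective u (vecs-unique u n)

-- Laurent polynomials acting on families of coefficients

variable
  d : ℕ

Point : ℕ → Set
Point d = Vec ℤ d

Fun : ℕ → Set
Fun d = Point d → ℤ

infixl 6 _⊕_
_⊕_ : Point d → Point d → Point d
_⊕_ = zipWith _+_

𝟎 : Point d
𝟎 = replicate _ 0ℤ

⊕-𝟎 : (x : Point d) → x ⊕ 𝟎 ≡ x
⊕-𝟎 = Vec.zipWith-identityʳ ℤ.+-identityʳ

⊕-swap : (x e f : Point d) → x ⊕ e ⊕ f ≡ x ⊕ f ⊕ e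
⊕-swap x e f =
  trans (Vec.zipWith-assoc ℤ.+-assoc x e f)
        (trans (cong (x ⊕_) (Vec.zipWith-comm ℤ.+-comm e f)) (sym (Vec.zipWith-assoc ℤ.+-assoc x f e)))

infixl 6 _⊞_
infixl 7 _⊠_

-- Laurent polynomials as syntax trees: a generating function is the family of
-- its coefficients, and mono c e multiplies it by c x^(-e).
data Op (d : ℕ) : Set where
  mono : ℤ → Point d → Op d
  _⊞_ _⊠_ : Op d → Op d → Op d

act : Op d → Fun d → Fun d
act (mono c e) f x = c * f (x ⊕ e)
act (P ⊞ Q) f x = act P f x + act Q f x
act (P ⊠ Q) f = act P (act Q f)

act-cong : (P : Op d) {f g : Fun d} → f ≗ g → act P f ≗ act P g
act-cong (mono c e) eq x = cong (c *_) (eq (x ⊕ e))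
act-cong (P ⊞ Q) eq x = cong₂ _+_ (act-cong P eq x) (act-cong Q eq x)
act-cong (P ⊠ Q) eq = act-cong P (act-cong Q eq)

act-+ : (P : Op d) (f g : Fun d) → act P (λ x → f x + g x) ≗ λ x → act P f x + act P g x
act-+ (mono c e) f g x = ℤ.*-distribˡ-+ c (f (x ⊕ e)) (g (x ⊕ e))
act-+ (P ⊞ Q) f g x =
  trans (cong₂ _+_ (act-+ P f g x) (act-+ Q f g x))
        (interchange (act P f x) (act P g x) (act Q f x) (act Q g x))
act-+ (P ⊠ Q) f g x = trans (act-cong P (act-+ Q f g) x) (act-+ P (act Q f) (act Q g) x)

act-* : (P : Op d) (a : ℤ) (f : Fun d) → act P (λ x → a * f x) ≗ λ x → a * act P f x
act-* (mono c e) a f x = swap c a (f (x ⊕ e))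
  where
  swap : ∀ c a y → c * (a * y) ≡ a * (c * y)
  swap = solve-∀
act-* (P ⊞ Q) a f x =
  trans (cong₂ _+_ (act-* P a f x) (act-* Q a f x)) (sym (ℤ.*-distribˡ-+ a (act P f x) (act Q f x)))
act-* (P ⊠ Q) a f x = trans (act-cong P (act-* Q a f) x) (act-* P a (act Q f) x)

act-0 : (P : Op d) → act P (λ _ → 0ℤ) ≗ λ _ → 0ℤ
act-0 (mono c e) x = ℤ.*-zeroʳ c
act-0 (P ⊞ Q) x = cong₂ _+_ (act-0 P x) (act-0 Q x)
act-0 (P ⊠ Q) x = trans (act-cong P (act-0 Q) x) (act-0 P x)

act-∑ : (P : Op d) (is : List A) (r : A → ℤ) (g : A → Fun d) →
  act P (λ x → ∑ is (λ i → r i * g i x)) ≗ λ x → ∑ is (λ i → r i * act P (g i) x)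
act-∑ P [] r g x = act-0 P x
act-∑ P (i ∷ is) r g x =
  trans (act-+ P (λ y → r i * g i y) (λ y → ∑ is (λ j → r j * g j y)) x)
        (cong₂ _+_ (act-* P (r i) (g i) x) (act-∑ P is r g x))

act-shift : (P : Op d) (f : Fun d) (v : Point d) → act P (λ x → f (x ⊕ v)) ≗ λ x → act P f (x ⊕ v)
act-shift (mono c e) f v x = cong (λ z → c * f z) (⊕-swap x e v)
act-shift (P ⊞ Q) f v x = cong₂ _+_ (act-shift P f v x) (act-shift Q f v x)
act-shift (P ⊠ Q) f v x = trans (act-cong P (act-shift Q f v) x) (act-shift P (act Q f) v x)

-- A monomial is a shift times a scalar, and every operator commutes with both by `act-shift` and
-- `act-*`; induction on `P` does the rest. Only the actions commute, not the syntax trees.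
act-comm : (P Q : Op d) (f : Fun d) → act P (act Q f) ≗ act Q (act P f)
act-comm (mono c e) Q f x =
  trans (cong (c *_) (sym (act-shift Q f e x))) (sym (act-* Q c (λ y → f (y ⊕ e)) x))
act-comm (P ⊞ P′) Q f x =
  trans (cong₂ _+_ (act-comm P Q f x) (act-comm P′ Q f x)) (sym (act-+ Q (act P f) (act P′ f) x))
act-comm (P ⊠ P′) Q f x =
  trans (act-cong P (act-comm P′ Q f) x) (act-comm P Q (act P′ f) x)

-- Supports in boxes

InBox : ℕ → Point d → Set
InBox ρ = V.All (λ z → ∣ z ∣ ℕ.≤ ρ)

Supp : ℕ → Fun d → Set
Supp ρ f = ∀ x → ¬ InBox ρ x → f x ≡ 0ℤ

Supp-mono : ∀ {ρ σ} {f : Fun d} → ρ ℕ.≤ σ → Supp ρ f → Supp σ f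
Supp-mono ρ≤σ s x out = s x (λ b → out (V.map (λ p → ℕ.≤-trans p ρ≤σ) b))

Supp-+ : ∀ {ρ} {f g : Fun d} → Supp ρ f → Supp ρ g → Supp ρ (λ x → f x + g x)
Supp-+ s t x out = cong₂ _+_ (s x out) (t x out)

Supp-cong : ∀ {ρ} {f g : Fun d} → f ≗ g → Supp ρ g → Supp ρ f
Supp-cong eq s x out = trans (eq x) (s x out)

Supp-mul : ∀ {ρ} (w : Fun d) {f : Fun d} → Supp ρ f → Supp ρ (λ x → w x * f x)
Supp-mul w s x out = trans (cong (w x *_) (s x out)) (ℤ.*-zeroʳ (w x))

norm : Point d → ℕ
norm [] = 0
norm (z ∷ v) = ∣ z ∣ ℕ.+ norm v

InBox-norm : (v : Point d) → InBox (norm v) v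
InBox-norm [] = V.[]
InBox-norm (z ∷ v) =
  ℕ.m≤m+n ∣ z ∣ (norm v) V.∷ V.map (λ p → ℕ.≤-trans p (ℕ.m≤n+m (norm v) ∣ z ∣)) (InBox-norm v)

InBox-shift : ∀ {ρ σ} {v : Point d} → InBox σ v → ∀ x → InBox ρ (x ⊕ v) → InBox (σ ℕ.+ ρ) x
InBox-shift V.[] [] V.[] = V.[]
InBox-shift {ρ = ρ} {σ} (V._∷_ {x = e} p ps) (z ∷ x) (q V.∷ qs) = bound V.∷ InBox-shift ps x qs
  where
  cancel : ∀ z e → z ≡ - e + (z + e)
  cancel = solve-∀
  open ℕ.≤-Reasoning
  bound : ∣ z ∣ ℕ.≤ σ ℕ.+ ρ
  bound = begin
    ∣ z ∣                      ≡⟨ cong ∣_∣ (cancel z e) ⟩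
    ∣ - e + (z + e) ∣          ≤⟨ ℤ.∣i+j∣≤∣i∣+∣j∣ (- e) (z + e) ⟩
    ∣ - e ∣ ℕ.+ ∣ z + e ∣      ≡⟨ cong (ℕ._+ ∣ z + e ∣) (ℤ.∣-i∣≡∣i∣ e) ⟩
    ∣ e ∣ ℕ.+ ∣ z + e ∣        ≤⟨ ℕ.+-mono-≤ p q ⟩
    σ ℕ.+ ρ                    ∎

Supp-shift : ∀ {ρ σ} {v : Point d} {f : Fun d} → InBox σ v → Supp ρ f → Supp (σ ℕ.+ ρ) (λ x → f (x ⊕ v))
Supp-shift {v = v} b s x out = s (x ⊕ v) (λ c → out (InBox-shift b x c))

-- Bounds how far the action spreads a support. The sum for `⊞`, where a maximum would do, is
-- harmless: the dimension count only asks for linear growth in the exponent of `Q`.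
reach : Op d → ℕ
reach (mono c e) = norm e
reach (P ⊞ Q) = reach P ℕ.+ reach Q
reach (P ⊠ Q) = reach P ℕ.+ reach Q

Supp-act : ∀ {ρ} (P : Op d) {f : Fun d} → Supp ρ f → Supp (reach P ℕ.+ ρ) (act P f)
Supp-act (mono c e) s = Supp-mul (λ _ → c) (Supp-shift (InBox-norm e) s)
Supp-act {ρ = ρ} (P ⊞ Q) s =
  Supp-+ (Supp-mono (ℕ.+-monoˡ-≤ ρ (ℕ.m≤m+n (reach P) (reach Q))) (Supp-act P s))
         (Supp-mono (ℕ.+-monoˡ-≤ ρ (ℕ.m≤n+m (reach Q) (reach P))) (Supp-act Q s))
Supp-act {ρ = ρ} (P ⊠ Q) {f} s =
  subst (λ σ → Supp σ (act P (act Q f))) (sym (ℕ.+-assoc (reach P) (reach Q) ρ)) (Supp-act P (Supp-act Q s))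

-- Affine weights, derivations and powers of the denominator

Affine : Fun d → (Point d → ℤ) → Set
Affine w δ = ∀ x e → w (x ⊕ e) ≡ w x + δ e

-- The commutator of `act P` with an affine weight of linear part `δ`, by `leibniz`; up to sign it
-- is an Euler derivation. It changes no exponent, so `reach P` still bounds the spread in `Supp-∂`.
∂ : (Point d → ℤ) → Op d → Op d
∂ δ (mono c e) = mono (c * δ e) e
∂ δ (P ⊞ Q) = ∂ δ P ⊞ ∂ δ Q
∂ δ (P ⊠ Q) = ∂ δ P ⊠ Q ⊞ P ⊠ ∂ δ Q

Supp-∂ : (δ : Point d → ℤ) (P : Op d) {f : Fun d} → ∀ {ρ} → Supp ρ f → Supp (reach P ℕ.+ ρ) (act (∂ δ P) f)
Supp-∂ δ (mono c e) s = Supp-act (mono (c * δ e) e) s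
Supp-∂ δ (P ⊞ Q) {ρ = ρ} s =
  Supp-+ (Supp-mono (ℕ.+-monoˡ-≤ ρ (ℕ.m≤m+n (reach P) (reach Q))) (Supp-∂ δ P s))
         (Supp-mono (ℕ.+-monoˡ-≤ ρ (ℕ.m≤n+m (reach Q) (reach P))) (Supp-∂ δ Q s))
Supp-∂ δ (P ⊠ Q) {f} {ρ} s =
  subst (λ σ → Supp σ (act (∂ δ (P ⊠ Q)) f)) (sym (ℕ.+-assoc (reach P) (reach Q) ρ))
    (Supp-+ (Supp-∂ δ P (Supp-act Q s)) (Supp-act P (Supp-∂ δ Q s)))

leibniz : (w : Fun d) (δ : Point d → ℤ) → Affine w δ → (P : Op d) (f : Fun d) →
  act P (λ x → w x * f x) ≗ λ x → w x * act P f x + act (∂ δ P) f x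
leibniz w δ aff (mono c e) f x =
  trans (cong (λ z → c * (z * f (x ⊕ e))) (aff x e)) (expand c (w x) (δ e) (f (x ⊕ e)))
  where
  expand : ∀ c a b y → c * ((a + b) * y) ≡ a * (c * y) + c * b * y
  expand = solve-∀
leibniz w δ aff (P ⊞ Q) f x =
  trans (cong₂ _+_ (leibniz w δ aff P f x) (leibniz w δ aff Q f x))
        (collect (w x) (act P f x) (act Q f x) (act (∂ δ P) f x) (act (∂ δ Q) f x))
  where
  collect : ∀ w p q p′ q′ → (w * p + p′) + (w * q + q′) ≡ w * (p + q) + (p′ + q′)
  collect = solve-∀
leibniz w δ aff (P ⊠ Q) f x =
  trans (act-cong P (leibniz w δ aff Q f) x)
  (trans (act-+ P (λ y → w y * act Q f y) (act (∂ δ Q) f) x)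
  (trans (cong (_+ act P (act (∂ δ Q) f) x) (leibniz w δ aff P (act Q f) x))
         (ℤ.+-assoc (w x * act P (act Q f) x) (act (∂ δ P) (act Q f) x) (act P (act (∂ δ Q) f) x))))

-- The exponent is shifted: power Q e acts as Q^(e+1).
power : Op d → ℕ → Op d
power Q zero = Q
power Q (suc e) = Q ⊠ power Q e

-- `power Q (suc e)` is `Q^(e+2)`, hence the factor `2 + e`. Its derivative keeps a factor
-- `Q^(e+1)`, so on `f` it meets the numerator already confined to a box; therefore one more power
-- of `Q` pays for one differentiation.
∂-power : (δ : Point d → ℤ) (Q : Op d) (e : ℕ) (f : Fun d) →
  act (∂ δ (power Q (suc e))) f ≗ λ x → ℤ.+ (2 ℕ.+ e) * act (∂ δ Q) (act (power Q e) f) x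
∂-power δ Q zero f x =
  trans (cong (act (∂ δ Q) (act Q f) x +_) (act-comm Q (∂ δ Q) f x)) (double (act (∂ δ Q) (act Q f) x))
  where
  double : ∀ y → y + y ≡ ℤ.+ 2 * y
  double = solve-∀
∂-power δ Q (suc e) f x =
  trans (cong (act (∂ δ Q) Qᵉf x +_)
          (trans (act-cong Q (∂-power δ Q e f) x)
          (trans (act-* Q (ℤ.+ (2 ℕ.+ e)) (act (∂ δ Q) (act (power Q e) f)) x)
                 (cong (ℤ.+ (2 ℕ.+ e) *_) (act-comm Q (∂ δ Q) (act (power Q e) f) x)))))
        (next (ℤ.+ (2 ℕ.+ e)) (act (∂ δ Q) Qᵉf x))
  where
  Qᵉf = act (power Q (suc e)) f
  next : ∀ c y → y + c * y ≡ (ℤ.+ 1 + c) * y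
  next = solve-∀

-- Stands for `f = P / Q^(e+1)` with `P` supported in the box of radius `ρ`.
Tame : Op d → ℕ → ℕ → Fun d → Set
Tame Q e ρ f = Supp ρ (act (power Q e) f)

Tame-suc : ∀ (Q : Op d) e {ρ f} → Tame Q e ρ f → Tame Q (suc e) (reach Q ℕ.+ ρ) f
Tame-suc Q e s = Supp-act Q s

-- Differentiating P / Q^e raises the exponent of Q by one and the degree of
-- the numerator by that of Q; this linear growth drives the dimension count.
Tame-mul : ∀ (Q : Op d) e {ρ f} (w : Fun d) δ → Affine w δ →
  Tame Q e ρ f → Tame Q (suc e) (reach Q ℕ.+ ρ) (λ x → w x * f x)
Tame-mul Q e {f = f} w δ aff s =
  Supp-cong (leibniz w δ aff (power Q (suc e)) f)
    (Supp-+ (Supp-mul w (Supp-act Q s))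
            (Supp-cong (∂-power δ Q e f) (Supp-mul (λ _ → ℤ.+ (2 ℕ.+ e)) (Supp-∂ δ Q s))))

Tame-shift : ∀ (Q : Op d) e {ρ σ f} {v : Point d} → InBox σ v →
  Tame Q e ρ f → Tame Q e (σ ℕ.+ ρ) (λ x → f (x ⊕ v))
Tame-shift Q e {f = f} {v} b s = Supp-cong (act-shift (power Q e) f v) (Supp-shift b s)

Tame-cong : ∀ (Q : Op d) e {ρ} {f g : Fun d} → f ≗ g → Tame Q e ρ g → Tame Q e ρ f
Tame-cong Q e eq s = Supp-cong (act-cong (power Q e) eq) s

-- Causality in the length variable

Vanish : ℤ → Fun (suc m) → Set
Vanish N f = ∀ n γ → n ℤ.< N → f (n ∷ γ) ≡ 0ℤ

-- With `t` marking the length: no negative powers of `t`, divisible by `t`, and `1` plus a multiple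
-- of `t`. Phrasing this through the action avoids extracting coefficients from syntax trees.
Causal Pos Unit : Op (suc m) → Set
Causal P = ∀ f N → Vanish N f → Vanish N (act P f)
Pos P = ∀ f N → Vanish N f → ∀ n γ → n ℤ.≤ N → act P f (n ∷ γ) ≡ 0ℤ
Unit Q = ∀ f N → Vanish N f → ∀ n γ → n ℤ.≤ N → act Q f (n ∷ γ) ≡ f (n ∷ γ)

Pos⇒Causal : (P : Op (suc m)) → Pos P → Causal P
Pos⇒Causal P p f N v n γ n<N = p f N v n γ (ℤ.<⇒≤ n<N)

Unit⇒Causal : (Q : Op (suc m)) → Unit Q → Causal Q
Unit⇒Causal Q u f N v n γ n<N = trans (u f N v n γ (ℤ.<⇒≤ n<N)) (v n γ n<N)

Unit-⊠ : (P Q : Op (suc m)) → Unit P → Unit Q → Unit (P ⊠ Q)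
Unit-⊠ P Q u v f N van n γ n≤N =
  trans (u (act Q f) N (Unit⇒Causal Q v f N van) n γ n≤N) (v f N van n γ n≤N)

Unit-power : (Q : Op (suc m)) → Unit Q → ∀ e → Unit (power Q e)
Unit-power Q u zero = u
Unit-power Q u (suc e) = Unit-⊠ Q (power Q e) u (Unit-power Q u e)

Pos-⊞ : (P Q : Op (suc m)) → Pos P → Pos Q → Pos (P ⊞ Q)
Pos-⊞ P Q p q f N v n γ n≤N = cong₂ _+_ (p f N v n γ n≤N) (q f N v n γ n≤N)

Pos-⊠ : (P Q : Op (suc m)) → Causal P → Pos Q → Pos (P ⊠ Q)
Pos-⊠ P Q c q f N v n γ n≤N =
  trans (act-comm P Q f (n ∷ γ)) (q (act P f) N (c f N v) n γ n≤N)

-- The lowest nonzero layer of `f` would reappear unchanged in `act Q f`. The vanishing at negative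
-- lengths provides such a layer; on two-sided families `1 - t` kills the constants.
Unit-injective : (Q : Op (suc m)) → Unit Q → (f : Fun (suc m)) → Vanish 0ℤ f →
  (∀ x → act Q f x ≡ 0ℤ) → ∀ x → f x ≡ 0ℤ
Unit-injective Q u f v eq (n ∷ γ) = vanish (suc ∣ n ∣) n γ (below n)
  where
  vanish : ∀ j → Vanish (ℤ.+ j) f
  vanish zero = v
  vanish (suc j) n γ n<j =
    trans (sym (u f (ℤ.+ j) (vanish j) n γ (ℤ.i<j⇒i≤pred[j] n<j))) (eq (n ∷ γ))
  below : ∀ n → n ℤ.< ℤ.+ (suc ∣ n ∣)
  below (ℤ.+ n) = ℤ.+<+ (ℕ.n<1+n n)
  below ℤ.-[1+ n ] = ℤ.-<+

Pos-null : Pos {m} (mono 0ℤ 𝟎)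
Pos-null f N v n γ n≤N = refl

-- Elimination in systems of linear equations

FinSupp : Fun d → Set
FinSupp f = ∃ λ ρ → Supp ρ f

FinSupp-+ : {f g : Fun d} → FinSupp f → FinSupp g → FinSupp (λ x → f x + g x)
FinSupp-+ (ρ , s) (σ , t) =
  ρ ℕ.+ σ , Supp-+ (Supp-mono (ℕ.m≤m+n ρ σ) s) (Supp-mono (ℕ.m≤n+m σ ρ) t)

module _ {S : Set} (F : S → Fun (suc m)) where

  -- Combinations of the `F s` modulo finitely supported families. Coefficients are restricted to
  -- `Pos` so that the pivots of `eliminate` stay units.
  Span : List S → Fun (suc m) → Set
  Span [] g = FinSupp g
  Span (s ∷ ss) g =
    Σ (Op (suc m)) λ P → Pos P × Σ (Fun (suc m)) λ h → Span ss h × (∀ x → g x ≡ act P (F s) x + h x)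

  Span-cong : ∀ ss {f g} → f ≗ g → Span ss g → Span ss f
  Span-cong [] eq (ρ , s) = ρ , Supp-cong eq s
  Span-cong (s ∷ ss) eq (P , p , h , sp , e) = P , p , h , sp , λ x → trans (eq x) (e x)

  Span-+ : ∀ ss {f g} → Span ss f → Span ss g → Span ss (λ x → f x + g x)
  Span-+ [] s t = FinSupp-+ s t
  Span-+ (s ∷ ss) (P , p , h , sp , e) (Q , q , k , sq , e′) =
    P ⊞ Q , Pos-⊞ P Q p q , (λ x → h x + k x) , Span-+ ss sp sq ,
    λ x → trans (cong₂ _+_ (e x) (e′ x)) (interchange (act P (F s) x) (h x) (act Q (F s) x) (k x))

  Span-act : ∀ ss P {f} → Causal P → Span ss f → Span ss (act P f)
  Span-act [] P c (ρ , s) = reach P ℕ.+ ρ , Supp-act P s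
  Span-act (s ∷ ss) P c (Q , q , h , sp , e) =
    P ⊠ Q , Pos-⊠ P Q c q , act P h , Span-act ss P c sp ,
    λ x → trans (act-cong P e x) (act-+ P (act Q (F s)) h x)

  Span-fin : ∀ ss {f} → FinSupp f → Span ss f
  Span-fin [] s = s
  Span-fin (s ∷ ss) {f} fs =
    mono 0ℤ 𝟎 , Pos-null {m} , f , Span-fin ss fs , λ x → sym (ℤ.+-identityˡ (f x))

  Span-gen : ∀ ss {s} P → Pos P → s ∈ ss → Span ss (act P (F s))
  Span-gen (s ∷ ss) P p (here refl) =
    P , p , (λ _ → 0ℤ) , Span-fin ss (0 , λ _ _ → refl) , λ x → sym (ℤ.+-identityʳ (act P (F s) x))
  Span-gen (s ∷ ss) {t} P p (there t∈) =
    mono 0ℤ 𝟎 , Pos-null {m} , act P (F t) , Span-gen ss P p t∈ , λ x → sym (ℤ.+-identityˡ (act P (F t) x))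

  Span-FinSupp : ∀ ss (Q : Op (suc m)) → (∀ s → s ∈ ss → FinSupp (act Q (F s))) →
    ∀ {g} → Span ss g → FinSupp (act Q g)
  Span-FinSupp [] Q fin (ρ , s) = reach Q ℕ.+ ρ , Supp-act Q s
  Span-FinSupp (s ∷ ss) Q fin (P , p , h , sp , e) =
    let ρ , t = FinSupp-+ (let ρ , t = fin s (here refl) in reach P ℕ.+ ρ , Supp-act P t)
                          (Span-FinSupp ss Q (λ s s∈ → fin s (there s∈)) sp)
    in ρ , Supp-cong (λ x → trans (act-cong Q e x) (trans (act-+ Q (act P (F s)) h x)
                     (cong (_+ act Q h x) (act-comm Q P (F s) x)))) t

  -- Gaussian elimination; the pivots are units, so no division by zero occurs.
  eliminate : ∀ ss (E : Op (suc m)) → Unit E → (∀ s → s ∈ ss → Span ss (act E (F s))) →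
    Σ (Op (suc m)) λ Q → Unit Q × (∀ s → s ∈ ss → FinSupp (act Q (F s)))
  eliminate [] E u _ = E , u , λ _ ()
  eliminate (s ∷ ss) E u eqs with eqs s (here refl)
  ... | P , p , g , spg , eqg =
    Q ⊠ U , Unit-⊠ Q U uQ uU , fin
    where
    -- Moving the diagonal term of `E F_s = P F_s + g` to the left gives the pivot `E - P`, a unit
    -- because `P` is `Pos`.
    U = E ⊞ mono ℤ.-1ℤ 𝟎 ⊠ P
    act-U : ∀ f x → act U f x ≡ act E f x + - act P f x
    act-U f x = cong (act E f x +_)
      (trans (cong (λ y → ℤ.-1ℤ * act P f y) (⊕-𝟎 x)) (ℤ.-1*i≡-i (act P f x)))
    uU : Unit U
    uU f N v n γ n≤N = trans (act-U f (n ∷ γ))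
      (trans (cong₂ (λ a b → a + - b) (u f N v n γ n≤N) (p f N v n γ n≤N)) (ℤ.+-identityʳ (f (n ∷ γ))))
    cancel : ∀ a b → (a + b) + - a ≡ b
    cancel = solve-∀
    pivot : act U (F s) ≗ g
    pivot x = trans (act-U (F s) x) (trans (cong (_+ - act P (F s) x) (eqg x)) (cancel (act P (F s) x) (g x)))
    -- Multiplying the equation of `t` by `U` turns its term `R F_s` into `R g`, which is free of
    -- `F s`; the new common left factor is `U ⊠ E`.
    eqs′ : ∀ t → t ∈ ss → Span ss (act (U ⊠ E) (F t))
    eqs′ t t∈ with eqs t (there t∈)
    ... | R , r , h , sph , eqh = Span-cong ss
      (λ x → trans (act-cong U eqh x) (trans (act-+ U (act R (F s)) h x)
        (cong (_+ act U h x) (trans (act-comm U R (F s) x) (act-cong R pivot x)))))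
      (Span-+ ss (Span-act ss R (Pos⇒Causal R r) spg) (Span-act ss U (Unit⇒Causal U uU) sph))
    rec = eliminate ss (U ⊠ E) (Unit-⊠ U E uU u) eqs′
    Q = proj₁ rec
    uQ = proj₁ (proj₂ rec)
    fin : ∀ t → t ∈ s ∷ ss → FinSupp (act (Q ⊠ U) (F t))
    fin .s (here refl) =
      let ρ , w = Span-FinSupp ss Q (proj₂ (proj₂ rec)) spg in ρ , Supp-cong (act-cong Q pivot) w
    fin t (there t∈) =
      let ρ , w = proj₂ (proj₂ rec) t t∈ in reach U ℕ.+ ρ , Supp-cong (act-comm Q U (F t)) (Supp-act U w)

-- Linear dependence over the integers

*-nonzero : ∀ {a b} → a ≢ 0ℤ → b ≢ 0ℤ → a * b ≢ 0ℤ
*-nonzero {a} a≢0 b≢0 ab≡0 = [ a≢0 , b≢0 ]′ (ℤ.i*j≡0⇒i≡0∨j≡0 a ab≡0)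

∑-single : {xs : List A} → Unique xs → ∀ {x} → x ∈ xs → {g : A → ℤ} →
  (∀ y → y ∈ xs → y ≢ x → g y ≡ 0ℤ) → ∑ xs g ≡ g x
∑-single {xs = x ∷ xs} (x∉ ∷ u) (here refl) {g} z =
  trans (cong (g x +_) (∑-zero xs λ y y∈ → z y (there y∈) λ y≡x → All.lookup x∉ y∈ (sym y≡x)))
        (ℤ.+-identityʳ (g x))
∑-single {xs = x ∷ xs} (x∉ ∷ u) {t} (there t∈) {g} z =
  trans (cong₂ _+_ (z x (here refl) (All.lookup x∉ t∈)) (∑-single u t∈ (λ y y∈ → z y (there y∈))))
        (ℤ.+-identityˡ (g t))

module _ {I X : Set} (_≟_ : DecidableEquality I) where

  pick : I → ℤ → (I → ℤ) → I → ℤ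
  pick i a r j = if does (j ≟ i) then a else r j

  pick-≡ : ∀ i a r → pick i a r i ≡ a
  pick-≡ i a r with i ≟ i
  ... | yes _ = refl
  ... | no i≢i = ⊥-elim (i≢i refl)

  pick-≢ : ∀ i a r {j} → i ≢ j → pick i a r j ≡ r j
  pick-≢ i a r {j} i≢j with j ≟ i
  ... | yes j≡i = ⊥-elim (i≢j (sym j≡i))
  ... | no _ = refl

  -- Fraction-free elimination. A function that vanishes at all points is a relation by itself;
  -- otherwise some `g i p` is a pivot, cross-multiplication makes the other functions vanish at
  -- `p`, and `i` and `p` are both dropped.
  nontrivial-relation : (is : List I) → Unique is → (xs : List X) (g : I → X → ℤ) →
    length xs ℕ.< length is →
    Σ (I → ℤ) λ r → (∃ λ i → i ∈ is × r i ≢ 0ℤ) × (∀ x → x ∈ xs → ∑ is (λ i → r i * g i x) ≡ 0ℤ)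
  nontrivial-relation (i ∷ is) (i∉ ∷ u) xs g (ℕ.s≤s xs≤is) with all? (λ x → g i x ℤ.≟ 0ℤ) xs
  ... | yes zero-on-xs =
    r , (i , here refl , λ e → contradiction (trans (sym (pick-≡ i 1ℤ _)) e) λ ()) ,
    λ x x∈ → ∑-zero (i ∷ is) (λ j _ → term j (All.lookup zero-on-xs x∈))
    where
    r = pick i 1ℤ (λ _ → 0ℤ)
    term : ∀ j {x} → g i x ≡ 0ℤ → r j * g j x ≡ 0ℤ
    term j {x} e with j ≟ i
    ... | yes refl = trans (ℤ.*-identityˡ (g i x)) e
    ... | no _ = refl
  ... | no ¬zero with find (¬All⇒Any¬ (λ x → g i x ℤ.≟ 0ℤ) xs ¬zero)
  ... | p , p∈ , a≢0 with ∈-∃++ p∈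
  ... | as , bs , refl = r , (k , there k∈ , nonzero) , relation
    where
    a = g i p
    g′ : I → X → ℤ
    g′ j x = a * g j x + - (g j p * g i x)
    rec = nontrivial-relation is u (as ++ bs) g′
            (ℕ.≤-trans (ℕ.≤-reflexive (sym (length-++-sucʳ as p bs))) xs≤is)
    s = proj₁ rec
    k = proj₁ (proj₁ (proj₂ rec))
    k∈ = proj₁ (proj₂ (proj₁ (proj₂ rec)))
    S = ∑ is (λ j → s j * g j p)
    t : I → ℤ
    t j = a * s j
    -- Undoes the cross-multiplication: expanding the `g′ j` in the relation `s` leaves `g i` with
    -- coefficient `- S` and `g j` with `a * s j`.
    r = pick i (- S) t
    nonzero : r k ≢ 0ℤ
    nonzero e = *-nonzero a≢0 (proj₂ (proj₂ (proj₁ (proj₂ rec))))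
                  (trans (sym (pick-≢ i (- S) t (All.lookup i∉ k∈))) e)
    split : ∀ x → ∑ (i ∷ is) (λ j → r j * g j x) ≡ ∑ is (λ j → s j * g′ j x)
    split x = begin
      r i * g i x + ∑ is (λ j → r j * g j x)
        ≡⟨ cong₂ _+_ (cong (_* g i x) (pick-≡ i (- S) t))
             (∑-cong is λ j j∈ → cong (_* g j x) (pick-≢ i (- S) t (All.lookup i∉ j∈))) ⟩
      - S * g i x + ∑ is (λ j → a * s j * g j x)
        ≡⟨ cong (_+ ∑ is (λ j → a * s j * g j x)) (trans (neg S (g i x)) (∑-*ˡ (- g i x) is _)) ⟩
      ∑ is (λ j → - g i x * (s j * g j p)) + ∑ is (λ j → a * s j * g j x)
        ≡⟨ sym (∑-+ is _ _) ⟩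
      ∑ is (λ j → - g i x * (s j * g j p) + a * s j * g j x)
        ≡⟨ ∑-cong is (λ j _ → rearrange a (g i x) (s j) (g j p) (g j x)) ⟩
      ∑ is (λ j → s j * g′ j x) ∎
      where
      open ≡-Reasoning
      neg : ∀ S y → - S * y ≡ - y * S
      neg = solve-∀
      rearrange : ∀ a y s v w → - y * (s * v) + a * s * w ≡ s * (a * w + - (v * y))
      rearrange = solve-∀
    at-pivot : ∀ j → s j * g′ j p ≡ 0ℤ
    at-pivot j = trans (cong (s j *_) (commute a (g j p))) (ℤ.*-zeroʳ (s j))
      where
      commute : ∀ a b → a * b + - (b * a) ≡ 0ℤ
      commute = solve-∀
    relation : ∀ x → x ∈ as ++ p ∷ bs → ∑ (i ∷ is) (λ j → r j * g j x) ≡ 0ℤ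
    relation x x∈ with ∈-++⁻ as x∈
    ... | inj₁ x∈as = trans (split x) (proj₂ (proj₂ rec) x (∈-++⁺ˡ x∈as))
    ... | inj₂ (here refl) = trans (split x) (∑-zero is (λ j _ → at-pivot j))
    ... | inj₂ (there x∈bs) = trans (split x) (proj₂ (proj₂ rec) x (∈-++⁺ʳ as x∈bs))

-- Rising factorials and extraction of the coefficient at zero

least : {P : ℕ → Set} → Decidable P → ∀ a → P a → ∃ λ b → b ℕ.≤ a × P b × (∀ {c} → c ℕ.< b → ¬ P c)
least P? zero p = zero , ℕ.z≤n , p , λ ()
least {P} P? (suc a) p with P? 0
... | yes p₀ = 0 , ℕ.z≤n , p₀ , λ ()
... | no ¬p₀ with least (P? ∘ suc) a p
... | b , b≤a , q , below = suc b , ℕ.s≤s b≤a , q , below′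
  where
  below′ : ∀ {c} → c ℕ.< suc b → ¬ P c
  below′ {zero} _ = ¬p₀
  below′ {suc c} (ℕ.s≤s c<b) = below c<b

rising : ℤ → ℕ → ℤ
rising y zero = 1ℤ
rising y (suc c) = (y + ℤ.+ c) * rising y c

-- The factor `- a + a` occurs once `c` exceeds `a`. Evaluation at `- a` thus removes the larger
-- exponents; the smaller ones are left to minimality.
rising-zero : ∀ a {c} → a ℕ.< c → rising (- ℤ.+ a) c ≡ 0ℤ
rising-zero a {suc c} (ℕ.s≤s a≤c) with ℕ.m≤n⇒m<n∨m≡n a≤c
... | inj₁ a<c = trans (cong ((- ℤ.+ a + ℤ.+ c) *_) (rising-zero a a<c)) (ℤ.*-zeroʳ (- ℤ.+ a + ℤ.+ c))
... | inj₂ refl = cong (_* rising (- ℤ.+ a) a) (ℤ.+-inverseˡ (ℤ.+ a))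

rising-nonzero : ∀ a {c} → c ℕ.≤ a → rising (- ℤ.+ a) c ≢ 0ℤ
rising-nonzero a {zero} _ ()
rising-nonzero a {suc c} c<a = *-nonzero factor (rising-nonzero a (ℕ.<⇒≤ c<a))
  where
  solve-for-c : ∀ a c → - a + c ≡ 0ℤ → c ≡ a
  solve-for-c a c e = trans (shift a c) (trans (cong (a +_) e) (ℤ.+-identityʳ a))
    where
    shift : ∀ a c → c ≡ a + (- a + c)
    shift = solve-∀
  factor : - ℤ.+ a + ℤ.+ c ≢ 0ℤ
  factor e = ℕ.<⇒≢ c<a (ℤ.+-injective (solve-for-c (ℤ.+ a) (ℤ.+ c) e))

risings : Vec ℕ m → Point m → ℤ
risings [] [] = 1ℤ
risings (c ∷ cs) (y ∷ γ) = rising y c * risings cs γ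

up : Vec ℕ m → Point m
up = Vec.map (λ c → ℤ.+ c)

-- The sum is Σ_c ∂^c φ_c read off at x^γ up to a shift of indices.  Evaluated
-- at γ = -c for a minimal c with φ_c ≠ 0, only the term of c itself survives.
residue : (D m : ℕ) (φ : ℤ → Vec ℕ m → Point m → ℤ) (Z : Vec ℕ m → Set) → Decidable Z →
  (∀ c → Z c → ∀ N γ → φ N c γ ≡ 0ℤ) →
  (∀ N γ → ∑ (vecs (upTo D) m) (λ c → risings c γ * φ N c (γ ⊕ up c)) ≡ 0ℤ) →
  (∃ λ c → c ∈ vecs (upTo D) m × ¬ Z c) →
  ∃ λ c → ¬ Z c × (∀ N → φ N c 𝟎 ≡ 0ℤ)
residue D zero φ Z Z? z rel ([] , _ , ¬z) =
  [] , ¬z , λ N → trans (unit (φ N [] [])) (rel N [])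
  where
  unit : ∀ y → y ≡ 1ℤ * y + 0ℤ
  unit = solve-∀
residue D (suc m) φ Z Z? z rel (c , c∈ , ¬z)
  with ∈-cartesianProductWith⁻ _∷_ (upTo D) (vecs (upTo D) m) c∈
-- Minimality is lexicographic: `a` is the least first entry occurring outside `Z`, and the other
-- entries are found recursively with the first coordinate fixed at `0`.
... | b , cs , b∈ , cs∈ , refl with least (λ a → any? (λ cs → ¬? (Z? (a ∷ cs))) (vecs (upTo D) m)) b (lose cs∈ ¬z)
... | a , a≤b , some , below =
  let cs , cs∈ , ¬zcs = find some
      c , ¬zc , eq = residue D m (λ N c γ → φ N (a ∷ c) (0ℤ ∷ γ)) (λ c → Z (a ∷ c)) (λ c → Z? (a ∷ c))
                       (λ c zc N γ → z (a ∷ c) zc N (0ℤ ∷ γ)) rel′ (cs , cs∈ , ¬zcs)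
  in a ∷ c , ¬zc , eq
  where
  cube = vecs (upTo D) m
  y = - ℤ.+ a
  term : ℤ → Point m → ℕ → ℤ
  term N γ b = ∑ cube (λ c → rising y b * risings c γ * φ N (b ∷ c) (y + ℤ.+ b ∷ γ ⊕ up c))
  a∈ : a ∈ upTo D
  a∈ = ∈-upTo⁺ (ℕ.≤-<-trans a≤b (∈-upTo⁻ b∈))
  other : ∀ N γ b → b ∈ upTo D → b ≢ a → term N γ b ≡ 0ℤ
  other N γ b b∈ b≢a with ℕ.<-cmp b a
  ... | tri≈ _ b≡a _ = ⊥-elim (b≢a b≡a)
  ... | tri> _ _ a<b = ∑-zero cube λ c _ →
    cong (λ w → w * risings c γ * φ N (b ∷ c) (y + ℤ.+ b ∷ γ ⊕ up c)) (rising-zero a a<b)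
  ... | tri< b<a _ _ = ∑-zero cube λ c c∈ → vanish c (Z? (b ∷ c)) c∈
    where
    vanish : ∀ c → Dec (Z (b ∷ c)) → c ∈ cube → rising y b * risings c γ * φ N (b ∷ c) (y + ℤ.+ b ∷ γ ⊕ up c) ≡ 0ℤ
    vanish c (yes zc) _ = trans (cong (rising y b * risings c γ *_) (z (b ∷ c) zc N _)) (ℤ.*-zeroʳ (rising y b * risings c γ))
    vanish c (no ¬zc) c∈ = ⊥-elim (below b<a (lose c∈ ¬zc))
  rel′ : ∀ N γ → ∑ cube (λ c → risings c γ * φ N (a ∷ c) (0ℤ ∷ (γ ⊕ up c))) ≡ 0ℤ
  -- Only the summands with first exponent `a` survive. Their shift `- a + a` puts the coordinate at
  -- `0`, and the common factor `rising y a` cancels because it is nonzero.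
  rel′ N γ = [ (λ e → ⊥-elim (rising-nonzero a ℕ.≤-refl e)) , (λ e → e) ]′
               (ℤ.i*j≡0⇒i≡0∨j≡0 (rising y a) (begin
    rising y a * ∑ cube (λ c → risings c γ * φ N (a ∷ c) (0ℤ ∷ (γ ⊕ up c)))
      ≡⟨ ∑-*ˡ (rising y a) cube _ ⟩
    ∑ cube (λ c → rising y a * (risings c γ * φ N (a ∷ c) (0ℤ ∷ (γ ⊕ up c))))
      ≡⟨ ∑-cong cube (λ c _ → trans (sym (ℤ.*-assoc (rising y a) (risings c γ) _))
           (cong (λ w → rising y a * risings c γ * φ N (a ∷ c) (w ∷ (γ ⊕ up c))) (sym (ℤ.+-inverseˡ (ℤ.+ a))))) ⟩
    term N γ a
      ≡⟨ sym (∑-single (upTo⁺ D) a∈ {term N γ} (other N γ)) ⟩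
    ∑ (upTo D) (term N γ)
      ≡⟨ sym (∑-product _∷_ (upTo D) cube _) ⟩
    ∑ (vecs (upTo D) (suc m)) (λ c → risings c (y ∷ γ) * φ N c ((y ∷ γ) ⊕ up c))
      ≡⟨ rel N (y ∷ γ) ⟩
    0ℤ ∎))
    where open ≡-Reasoning

-- Growth of exponent and numerator under the weights

Additive : (Point d → Point m) → Set
Additive π = ∀ x e → π (x ⊕ e) ≡ π x ⊕ π e

head-⊕ : (x e : Point (suc d)) → head (x ⊕ e) ≡ head x + head e
head-⊕ (a ∷ x) (b ∷ e) = refl

tail-⊕ : (x e : Point (suc d)) → tail (x ⊕ e) ≡ tail x ⊕ tail e
tail-⊕ (a ∷ x) (b ∷ e) = refl

Affine-+ : (w : Fun d) (δ : Point d → ℤ) (a : ℤ) → Affine w δ → Affine (λ x → w x + a) δ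
Affine-+ w δ a aff x e = trans (cong (_+ a) (aff x e)) (swap (w x) (δ e) a)
  where
  swap : ∀ w d a → w + d + a ≡ w + a + d
  swap = solve-∀

module _ (Q : Op d) where

  private
    C = reach Q

  -- Expands the fraction by powers of `Q`, so that weights of different degrees reach a common
  -- exponent.
  Tame-pad : ∀ {e ρ f} {a b} → a ℕ.≤ b → Tame Q (a ℕ.+ e) (a ℕ.* C ℕ.+ ρ) f → Tame Q (b ℕ.+ e) (b ℕ.* C ℕ.+ ρ) f
  Tame-pad {e} {ρ} {f} {a} a≤b t = go (ℕ.≤⇒≤′ a≤b)
    where
    go : ∀ {b} → a ℕ.≤′ b → Tame Q (b ℕ.+ e) (b ℕ.* C ℕ.+ ρ) f
    go ℕ.≤′-refl = t
    go (ℕ.≤′-step {n = b} a≤b) =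
      Supp-mono (ℕ.≤-reflexive (sym (ℕ.+-assoc C (b ℕ.* C) ρ))) (Tame-suc Q (b ℕ.+ e) (go a≤b))

  Tame-step : ∀ {e ρ} b {f g} {w δ} → Affine w δ → (∀ x → g x ≡ w x * f x) →
    Tame Q (b ℕ.+ e) (b ℕ.* C ℕ.+ ρ) f → Tame Q (suc b ℕ.+ e) (suc b ℕ.* C ℕ.+ ρ) g
  Tame-step {e} {ρ} b {w = w} {δ} aff eq t =
    Tame-cong Q (suc b ℕ.+ e) eq
      (Supp-mono (ℕ.≤-reflexive (sym (ℕ.+-assoc C (b ℕ.* C) ρ))) (Tame-mul Q (b ℕ.+ e) w δ aff t))

  Tame-^ : ∀ {e ρ f} {w δ} → Affine w δ → Tame Q e ρ f →
    ∀ j → Tame Q (j ℕ.+ e) (j ℕ.* C ℕ.+ ρ) (λ x → w x ℤ.^ j * f x)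
  Tame-^ {e} {f = f} aff t zero = Tame-cong Q e (λ x → ℤ.*-identityˡ (f x)) t
  Tame-^ {f = f} {w} {δ} aff t (suc j) =
    Tame-step j {w = w} {δ} aff (λ x → ℤ.*-assoc (w x) (w x ℤ.^ j) (f x)) (Tame-^ aff t j)

  Tame-rising : ∀ {e ρ f} {w δ} → Affine w δ → Tame Q e ρ f →
    ∀ c → Tame Q (c ℕ.+ e) (c ℕ.* C ℕ.+ ρ) (λ x → rising (w x) c * f x)
  Tame-rising {e} {f = f} aff t zero = Tame-cong Q e (λ x → ℤ.*-identityˡ (f x)) t
  Tame-rising {f = f} {w} {δ} aff t (suc c) =
    Tame-step c {w = λ x → w x + ℤ.+ c} {δ} (Affine-+ w δ (ℤ.+ c) aff)
      (λ x → ℤ.*-assoc (w x + ℤ.+ c) (rising (w x) c) (f x)) (Tame-rising aff t c)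

  -- `π` selects the coordinates still to be treated; additivity makes its head an affine weight.
  -- Padding each coordinate to `D` multiplications makes the exponent independent of `c`.
  Tame-risings : ∀ D {e ρ f} (π : Point d → Point m) → Additive π → Tame Q e ρ f →
    ∀ c → c ∈ vecs (upTo D) m →
    Tame Q (m ℕ.* D ℕ.+ e) (m ℕ.* D ℕ.* C ℕ.+ ρ) (λ x → risings c (π x) * f x)
  Tame-risings {m = zero} D {e} {f = f} π add t [] _ =
    Tame-cong Q e (λ x → trans (cong (_* f x) (one (π x))) (ℤ.*-identityˡ (f x))) t
    where
    one : ∀ γ → risings [] γ ≡ 1ℤ
    one [] = refl
  Tame-risings {m = suc m} D {e} {ρ} {f} π add t c c∈
    with ∈-cartesianProductWith⁻ _∷_ (upTo D) (vecs (upTo D) m) c∈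
  ... | b , cs , b∈ , cs∈ , refl =
    subst₂ (λ e ρ → Tame Q e ρ (λ x → risings (b ∷ cs) (π x) * f x))
      (sym (ℕ.+-assoc D (m ℕ.* D) e)) (distribute D (m ℕ.* D) C ρ)
      (Tame-pad (ℕ.<⇒≤ (∈-upTo⁻ b∈))
        (Tame-cong Q (b ℕ.+ (m ℕ.* D ℕ.+ e)) (λ x → split (π x) (f x))
          (Tame-rising {w = head ∘ π} {δ = head ∘ π}
            (λ x e → trans (cong head (add x e)) (head-⊕ (π x) (π e)))
            (Tame-risings D (tail ∘ π) (λ x e → trans (cong tail (add x e)) (tail-⊕ (π x) (π e))) t cs cs∈) b)))
    where
    split : ∀ γ y → risings (b ∷ cs) γ * y ≡ rising (head γ) b * (risings cs (tail γ) * y)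
    split (z ∷ γ) y = ℤ.*-assoc (rising z b) (risings cs γ) y
    distribute : ∀ D k C ρ → D ℕ.* C ℕ.+ (k ℕ.* C ℕ.+ ρ) ≡ (D ℕ.+ k) ℕ.* C ℕ.+ ρ
    distribute = ℕ-Solver.solve-∀

-- Comparing the number of functions with the number of points

range : ℕ → List ℤ
range ρ = map ℤ.+_ (upTo (suc ρ)) ++ map ℤ.-[1+_] (upTo ρ)

length-range : ∀ ρ → length (range ρ) ≡ suc (ρ ℕ.+ ρ)
length-range ρ = trans (length-++ (map ℤ.+_ (upTo (suc ρ))))
  (cong₂ ℕ._+_ (trans (length-map ℤ.+_ (upTo (suc ρ))) (length-upTo (suc ρ)))
               (trans (length-map ℤ.-[1+_] (upTo ρ)) (length-upTo ρ)))

∈-range : ∀ {ρ} z → ∣ z ∣ ℕ.≤ ρ → z ∈ range ρ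
∈-range (ℤ.+ n) n≤ρ = ∈-++⁺ˡ (∈-map⁺ ℤ.+_ (∈-upTo⁺ (ℕ.s≤s n≤ρ)))
∈-range {ρ} ℤ.-[1+ n ] n<ρ = ∈-++⁺ʳ (map ℤ.+_ (upTo (suc ρ))) (∈-map⁺ ℤ.-[1+_] (∈-upTo⁺ n<ρ))

-- The summands account for the powers of `N - 2D`, the rising factorials in `m` coordinates, the
-- shift by `2i` and `c`, and the numerator of `F`. One multiplication by an affine weight costs
-- `C`.
radius : (D C m ρ₀ : ℕ) → ℕ
radius D C m ρ₀ = D ℕ.* C ℕ.+ (m ℕ.* D ℕ.* C ℕ.+ ((D ℕ.+ D) ℕ.+ ρ₀))

radius-small : ∀ C m ρ₀ → ∃ λ D →
  suc (radius D C m ρ₀ ℕ.+ radius D C m ρ₀) ℕ.^ suc m ℕ.< D ℕ.^ m ℕ.* (D ℕ.* D)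
-- For positive `D` the radius is at most `κ * D`, so the box has at most `(K * D)^(m+1)` points;
-- this is less than `D^(m+2)` once `D` exceeds `K^(m+1)`.
radius-small C m ρ₀ = suc (K ℕ.^ suc m) , small (suc (K ℕ.^ suc m)) (ℕ.n<1+n (K ℕ.^ suc m))
  where
  κ = C ℕ.+ (m ℕ.* C ℕ.+ (2 ℕ.+ ρ₀))
  K = suc (κ ℕ.+ κ)
  small : ∀ D → K ℕ.^ suc m ℕ.< D → suc (radius D C m ρ₀ ℕ.+ radius D C m ρ₀) ℕ.^ suc m ℕ.< D ℕ.^ m ℕ.* (D ℕ.* D)
  small D@(suc _) K<D = begin-strict
    suc (radius D C m ρ₀ ℕ.+ radius D C m ρ₀) ℕ.^ suc m ≤⟨ ℕ.^-monoˡ-≤ (suc m) (ℕ.s≤s (ℕ.+-mono-≤ ρ≤ ρ≤)) ⟩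
    suc (κ ℕ.* D ℕ.+ κ ℕ.* D) ℕ.^ suc m        ≤⟨ ℕ.^-monoˡ-≤ (suc m) bound ⟩
    (K ℕ.* D) ℕ.^ suc m                        ≡⟨ ^-distrib K D (suc m) ⟩
    K ℕ.^ suc m ℕ.* D ℕ.^ suc m                <⟨ ℕ.*-monoˡ-< (D ℕ.^ suc m) {{ℕ.m^n≢0 D (suc m)}} K<D ⟩
    D ℕ.* D ℕ.^ suc m                          ≡⟨ rearrange D (D ℕ.^ m) ⟩
    D ℕ.^ m ℕ.* (D ℕ.* D)                      ∎
    where
    open ℕ.≤-Reasoning
    ^-distrib : ∀ a b n → (a ℕ.* b) ℕ.^ n ≡ a ℕ.^ n ℕ.* b ℕ.^ n
    ^-distrib a b zero = refl
    ^-distrib a b (suc n) = trans (cong (a ℕ.* b ℕ.*_) (^-distrib a b n)) (swap a b (a ℕ.^ n) (b ℕ.^ n))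
      where
      swap : ∀ a b x y → a ℕ.* b ℕ.* (x ℕ.* y) ≡ a ℕ.* x ℕ.* (b ℕ.* y)
      swap = ℕ-Solver.solve-∀
    rearrange : ∀ D x → D ℕ.* (D ℕ.* x) ≡ x ℕ.* (D ℕ.* D)
    rearrange = ℕ-Solver.solve-∀
    expand : ∀ D C m ρ₀ → D ℕ.* C ℕ.+ (m ℕ.* D ℕ.* C ℕ.+ ((D ℕ.+ D) ℕ.+ ρ₀ ℕ.* D)) ≡ (C ℕ.+ (m ℕ.* C ℕ.+ (2 ℕ.+ ρ₀))) ℕ.* D
    expand = ℕ-Solver.solve-∀
    ρ≤ : radius D C m ρ₀ ℕ.≤ κ ℕ.* D
    ρ≤ = ℕ.≤-trans
      (ℕ.+-monoʳ-≤ (D ℕ.* C) (ℕ.+-monoʳ-≤ (m ℕ.* D ℕ.* C) (ℕ.+-monoʳ-≤ (D ℕ.+ D) (ℕ.m≤m*n ρ₀ D))))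
      (ℕ.≤-reflexive (expand D C m ρ₀))
    bound : suc (κ ℕ.* D ℕ.+ κ ℕ.* D) ℕ.≤ K ℕ.* D
    bound = ℕ.+-mono-≤ {1} {D} (ℕ.s≤s ℕ.z≤n) (ℕ.≤-reflexive (sym (ℕ.*-distribʳ-+ D κ κ)))

-- The recurrence at balance zero

module _ {m : ℕ} (F : Fun (suc m)) (Q : Op (suc m)) (unit : Unit Q) (ρ₀ : ℕ)
         (supp : Supp ρ₀ (act Q F)) (van : Vanish 0ℤ F)
         (D : ℕ) (large : suc (radius D (reach Q) m ρ₀ ℕ.+ radius D (reach Q) m ρ₀) ℕ.^ suc m ℕ.< D ℕ.^ m ℕ.* (D ℕ.* D)) where

  private
    C = reach Q
    ρ = radius D C m ρ₀
    -- Room for `D` factors `N - 2D` and `m * D` factors of rising factorials, each costing one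
    -- power; the final `0` is the exponent of `F`, since `power Q 0` is `Q`.
    e = D ℕ.+ (m ℕ.* D ℕ.+ 0)

    Index : Set
    Index = Vec ℕ m × (ℕ × ℕ)

    cube = vecs (upTo D) m
    square = cartesianProductWith _,_ (upTo D) (upTo D)
    indices : List Index
    indices = cartesianProductWith _,_ cube square

    points : List (Point (suc m))
    points = vecs (range ρ) (suc m)

    _≟ᵢ_ : DecidableEquality Index
    _≟ᵢ_ = ×-≡-dec (Vec.≡-dec ℕ._≟_) (×-≡-dec ℕ._≟_ ℕ._≟_)

    unique-square : Unique square
    unique-square = cartesianProductWith⁺ _,_ ,-injective (upTo⁺ D) (upTo⁺ D)

    unique-indices : Unique indices
    unique-indices = cartesianProductWith⁺ _,_ ,-injective (vecs-unique (upTo⁺ D) m) unique-square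

    few-points : length points ℕ.< length indices
    few-points = begin-strict
      length points                 ≡⟨ length-vecs (range ρ) (suc m) ⟩
      length (range ρ) ℕ.^ suc m    ≡⟨ cong (ℕ._^ suc m) (length-range ρ) ⟩
      suc (ρ ℕ.+ ρ) ℕ.^ suc m       <⟨ large ⟩
      D ℕ.^ m ℕ.* (D ℕ.* D)         ≡⟨ cong₂ ℕ._*_ (sym length-cube) (sym length-square) ⟩
      length cube ℕ.* length square ≡⟨ sym (length-product _,_ cube square) ⟩
      length indices                ∎
      where
      open ℕ.≤-Reasoning
      length-cube : length cube ≡ D ℕ.^ m
      length-cube = trans (length-vecs (upTo D) m) (cong (ℕ._^ m) (length-upTo D))
      length-square : length square ≡ D ℕ.* D
      length-square = trans (length-product _,_ (upTo D) (upTo D)) (cong₂ ℕ._*_ (length-upTo D) (length-upTo D))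

    shift : Vec ℕ m → ℕ → Point (suc m)
    shift c i = - ℤ.+ (2 ℕ.* i) ∷ up c

    -- Shifting the length backwards keeps these functions zero at negative lengths. The offset
    -- `2 * D` is chosen because at length `2(n + D)` the weight becomes `2n`.
    g : Index → Fun (suc m)
    g (c , i , j) x = (head x + - ℤ.+ (2 ℕ.* D)) ℤ.^ j * (risings c (tail x) * F (x ⊕ shift c i))

    g-tame : ∀ i → i ∈ indices → Tame Q e ρ (g i)
    g-tame i i∈ with ∈-cartesianProductWith⁻ _,_ cube square i∈
    ... | c , ij , c∈ , ij∈ , refl with ∈-cartesianProductWith⁻ _,_ (upTo D) (upTo D) ij∈
    ... | i , j , i∈ , j∈ , refl =
      Tame-pad Q (ℕ.<⇒≤ (∈-upTo⁻ j∈))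
        (Tame-^ Q {w = λ x → head x + - ℤ.+ (2 ℕ.* D)} {δ = head} (Affine-+ head head (- ℤ.+ (2 ℕ.* D)) head-⊕)
          (Tame-risings Q D tail tail-⊕ (Tame-shift Q 0 {v = shift c i} (i-bound V.∷ up-bound c c∈) supp) c c∈) j)
      where
      i-bound : ∣ - ℤ.+ (2 ℕ.* i) ∣ ℕ.≤ D ℕ.+ D
      i-bound = begin
        ∣ - ℤ.+ (2 ℕ.* i) ∣ ≡⟨ ℤ.∣-i∣≡∣i∣ (ℤ.+ (2 ℕ.* i)) ⟩
        i ℕ.+ (i ℕ.+ 0)     ≡⟨ cong (i ℕ.+_) (ℕ.+-identityʳ i) ⟩
        i ℕ.+ i             ≤⟨ ℕ.+-mono-≤ (ℕ.<⇒≤ (∈-upTo⁻ i∈)) (ℕ.<⇒≤ (∈-upTo⁻ i∈)) ⟩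
        D ℕ.+ D             ∎
        where open ℕ.≤-Reasoning
      up-bound : ∀ {m} (c : Vec ℕ m) → c ∈ vecs (upTo D) m → InBox (D ℕ.+ D) (up c)
      up-bound [] _ = V.[]
      up-bound {suc m} c c∈ with ∈-cartesianProductWith⁻ _∷_ (upTo D) (vecs (upTo D) m) c∈
      ... | b , cs , b∈ , cs∈ , refl =
        ℕ.≤-trans (ℕ.<⇒≤ (∈-upTo⁻ b∈)) (ℕ.m≤m+n D D) V.∷ up-bound cs cs∈

    g-vanish : ∀ i n γ → n ℤ.< 0ℤ → g i (n ∷ γ) ≡ 0ℤ
    g-vanish (c , i , j) n γ n<0 =
      trans (cong (λ y → (n + - ℤ.+ (2 ℕ.* D)) ℤ.^ j * (risings c γ * y))
              (van (n + - ℤ.+ (2 ℕ.* i)) (γ ⊕ up c)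
                (ℤ.≤-<-trans (ℤ.i-j≤i n (ℤ.+ (2 ℕ.* i))) n<0)))
            (absorb ((n + - ℤ.+ (2 ℕ.* D)) ℤ.^ j) (risings c γ))
      where
      absorb : ∀ a b → a * (b * 0ℤ) ≡ 0ℤ
      absorb = solve-∀

  diagonal-recurrence : Σ (ℕ → ℕ → ℤ) λ r →
    (∃ λ i → ∃ λ j → i ℕ.< D × j ℕ.< D × r i j ≢ 0ℤ) ×
    (∀ N → ∑ (upTo D) (λ i → ∑ (upTo D) (λ j →
       r i j * ((N + - ℤ.+ (2 ℕ.* D)) ℤ.^ j * F (N + - ℤ.+ (2 ℕ.* i) ∷ 𝟎)))) ≡ 0ℤ)
  diagonal-recurrence
    with nontrivial-relation _≟ᵢ_ indices unique-indices points (λ i → act (power Q e) (g i)) few-points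
  ... | r , (k , k∈ , rk≢0) , on-points =
    (λ i j → r (c₀ , i , j)) , nontrivial ,
    λ N → trans (sym (∑-product _,_ (upTo D) (upTo D) _)) (trans (∑-cong square λ _ _ → refl) (recurrence N))
    where
    G : Fun (suc m)
    G x = ∑ indices (λ i → r i * g i x)

    -- Outside the box every numerator is zero, so a relation at finitely many points holds
    -- everywhere.
    on-all : ∀ x → ∑ indices (λ i → r i * act (power Q e) (g i) x) ≡ 0ℤ
    on-all x with V.all? (λ z → ∣ z ∣ ℕ.≤? ρ) x
    ... | yes b = on-points x (∈-vecs (V.map (∈-range _) b))
    ... | no ¬b = ∑-zero indices λ i i∈ → trans (cong (r i *_) (g-tame i i∈ x ¬b)) (ℤ.*-zeroʳ (r i))

    -- Cancelling the common denominator turns the relation among numerators into one among the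
    -- functions.
    G≡0 : ∀ x → G x ≡ 0ℤ
    G≡0 = Unit-injective (power Q e) (Unit-power Q unit e) G
      (λ n γ n<0 → ∑-zero indices λ i _ → trans (cong (r i *_) (g-vanish i n γ n<0)) (ℤ.*-zeroʳ (r i)))
      (λ x → trans (act-∑ (power Q e) indices r g x) (on-all x))

    -- A condition on finitely many coefficients, hence decidable, as the search for a minimal `c`
    -- demands.
    Z : Vec ℕ m → Set
    Z c = All (λ ij → r (c , ij) ≡ 0ℤ) square

    coef : ℤ → ℕ × ℕ → Point m → ℤ
    coef N (i , j) γ = (N + - ℤ.+ (2 ℕ.* D)) ℤ.^ j * F (N + - ℤ.+ (2 ℕ.* i) ∷ γ)

    φ : ℤ → Vec ℕ m → Point m → ℤ
    φ N c γ = ∑ square (λ ij → r (c , ij) * coef N ij γ)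

    φ-relation : ∀ N γ → ∑ cube (λ c → risings c γ * φ N c (γ ⊕ up c)) ≡ 0ℤ
    φ-relation N γ = begin
      ∑ cube (λ c → risings c γ * φ N c (γ ⊕ up c))
        ≡⟨ ∑-cong cube (λ c _ → trans (∑-*ˡ (risings c γ) square _) (∑-cong square λ { (i , j) _ →
             swap (risings c γ) (r (c , i , j)) ((N + - ℤ.+ (2 ℕ.* D)) ℤ.^ j) (F (N + - ℤ.+ (2 ℕ.* i) ∷ γ ⊕ up c)) })) ⟩
      ∑ cube (λ c → ∑ square (λ ij → r (c , ij) * g (c , ij) (N ∷ γ)))
        ≡⟨ sym (∑-product _,_ cube square _) ⟩
      G (N ∷ γ)
        ≡⟨ G≡0 (N ∷ γ) ⟩
      0ℤ ∎
      where
      open ≡-Reasoning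
      swap : ∀ s r w y → s * (r * (w * y)) ≡ r * (w * (s * y))
      swap = solve-∀

    some-c : ∃ λ c → c ∈ cube × ¬ Z c
    some-c with ∈-cartesianProductWith⁻ _,_ cube square k∈
    ... | c , ij , c∈ , ij∈ , refl = c , c∈ , λ z → rk≢0 (All.lookup z ij∈)

    extracted = residue D m φ Z (λ c → all? (λ ij → r (c , ij) ℤ.≟ 0ℤ) square)
      (λ c z N γ → ∑-zero square λ ij ij∈ → cong (_* coef N ij γ) (All.lookup z ij∈))
      φ-relation some-c

    c₀ = proj₁ extracted
    recurrence : ∀ N → φ N c₀ 𝟎 ≡ 0ℤ
    recurrence = proj₂ (proj₂ extracted)

    nontrivial : ∃ λ i → ∃ λ j → i ℕ.< D × j ℕ.< D × r (c₀ , i , j) ≢ 0ℤ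
    nontrivial with find (¬All⇒Any¬ (λ ij → r (c₀ , ij) ℤ.≟ 0ℤ) square (proj₁ (proj₂ extracted)))
    ... | ij , ij∈ , r≢0 with ∈-cartesianProductWith⁻ _,_ (upTo D) (upTo D) ij∈
    ... | i , j , i∈ , j∈ , refl = i , j , ∈-upTo⁻ i∈ , ∈-upTo⁻ j∈ , r≢0

-- Automata reading columns and their generating functions

Column : ℕ → Set
Column = Vec Bool

-- The counter of a row holds the excess of ones still to come: reading a one lowers it, reading a
-- zero raises it, and acceptance asks for zero.
sign : Bool → ℤ
sign true = ℤ.-1ℤ
sign false = 1ℤ

signs : Column m → Point m
signs = Vec.map sign

indicator : {P : Set} → Dec P → ℤ
indicator d = if does d then 1ℤ else 0ℤ

indicator-no : {P : Set} (d : Dec P) → ¬ P → indicator d ≡ 0ℤ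
indicator-no (yes p) ¬p = contradiction p ¬p
indicator-no (no _) _ = refl

length-filter : {P : A → Set} (P? : Decidable P) (xs : List A) →
  ℤ.+ length (filter P? xs) ≡ ∑ xs (λ x → indicator (P? x))
length-filter P? [] = refl
length-filter P? (x ∷ xs) with P? x
... | yes _ = cong (1ℤ +_) (length-filter P? xs)
... | no _ = trans (length-filter P? xs) (sym (ℤ.+-identityˡ _))

Span-∑ : {S : Set} (F : S → Fun (suc m)) → ∀ ss (xs : List A) (h : A → Fun (suc m)) →
  (∀ a → Span F ss (h a)) → Span F ss (λ x → ∑ xs (λ a → h a x))
Span-∑ F ss [] h sp = Span-fin F ss (0 , λ _ _ → refl)
Span-∑ F ss (a ∷ xs) h sp = Span-+ F ss (sp a) (Span-∑ F ss xs h sp)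

module Automaton {m : ℕ} {S : Set} (step : S → Column m → S) (accept : S → Bool) (columns : List (Column m)) where

  Accepts : S → Point m → Vec (Column m) n → Set
  Accepts s γ [] = accept s ≡ true × γ ≡ 𝟎
  Accepts s γ (c ∷ cs) = Accepts (step s c) (γ ⊕ signs c) cs

  accepts? : ∀ s γ → Decidable (Accepts {n} s γ)
  accepts? s γ [] = (accept s Bool.≟ true) ×-dec Vec.≡-dec ℤ._≟_ γ 𝟎
  accepts? s γ (c ∷ cs) = accepts? (step s c) (γ ⊕ signs c) cs

  count : S → ℕ → Point m → ℤ
  count s zero γ = indicator (accepts? s γ [])
  count s (suc n) γ = ∑ columns (λ c → count (step s c) n (γ ⊕ signs c))

  count-≡ : ∀ s n γ → count s n γ ≡ ℤ.+ length (filter (accepts? s γ) (vecs columns n))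
  count-≡ s n γ = trans (count-∑ s n γ) (sym (length-filter (accepts? s γ) (vecs columns n)))
    where
    count-∑ : ∀ s n γ → count s n γ ≡ ∑ (vecs columns n) (λ cs → indicator (accepts? s γ cs))
    count-∑ s zero γ = sym (ℤ.+-identityʳ (indicator (accepts? s γ [])))
    count-∑ s (suc n) γ = trans (∑-cong columns (λ c _ → count-∑ (step s c) n (γ ⊕ signs c)))
      (sym (∑-product _∷_ columns (vecs columns n) _))

  series : S → Fun (suc m)
  series s (ℤ.+ n ∷ γ) = count s n γ
  series s (ℤ.-[1+ _ ] ∷ γ) = 0ℤ

  initial : S → Fun (suc m)
  initial s (ℤ.+ zero ∷ γ) = count s 0 γ
  initial s (ℤ.+ suc _ ∷ γ) = 0ℤ
  initial s (ℤ.-[1+ _ ] ∷ γ) = 0ℤ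

  initial-supp : ∀ s → Supp 0 (initial s)
  initial-supp s (ℤ.+ suc _ ∷ γ) out = refl
  initial-supp s (ℤ.-[1+ _ ] ∷ γ) out = refl
  initial-supp s (ℤ.+ zero ∷ γ) out =
    indicator-no (accepts? s γ []) λ { (_ , refl) → out (zero-box (suc m)) }
    where
    zero-box : ∀ d → InBox 0 (𝟎 {d})
    zero-box zero = V.[]
    zero-box (suc d) = ℕ.z≤n V.∷ zero-box d

  letter : Column m → Op (suc m)
  letter c = mono 1ℤ (ℤ.-1ℤ ∷ signs c)

  letter-pos : ∀ c → Pos (letter c)
  letter-pos c f N v n γ n≤N =
    cong (1ℤ *_) (v (n + ℤ.-1ℤ) (γ ⊕ signs c) (ℤ.<-≤-trans (pred< n) n≤N))
    where
    pred< : ∀ n → n + ℤ.-1ℤ ℤ.< n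
    pred< n = subst (ℤ._< n) (ℤ.+-comm ℤ.-1ℤ n) (ℤ.i≤pred[j]⇒i<j ℤ.≤-refl)

  -- The transfer equations, splitting off the first column; `initial` is the share of the empty
  -- word.
  series-step : ∀ s → series s ≗ λ x → initial s x + ∑ columns (λ c → act (letter c) (series (step s c)) x)
  series-step s (ℤ.+ zero ∷ γ) =
    sym (trans (cong (count s 0 γ +_) (∑-zero columns λ _ _ → refl)) (ℤ.+-identityʳ (count s 0 γ)))
  series-step s (ℤ.+ suc n ∷ γ) =
    trans (∑-cong columns (λ c _ → sym (ℤ.*-identityˡ (count (step s c) n (γ ⊕ signs c)))))
          (sym (ℤ.+-identityˡ _))
  series-step s (ℤ.-[1+ n ] ∷ γ) = sym (trans (ℤ.+-identityˡ _) (∑-zero columns λ _ _ → refl))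

  module _ (states : List S) (complete : ∀ s → s ∈ states) where

    series-rational : Σ (Op (suc m)) λ Q → Unit Q × (∀ s → FinSupp (act Q (series s)))
    series-rational =
      let Q , unit , fin = eliminate series states 𝟏 unit-𝟏 λ s _ → Span-cong series states (λ x → trans (act-𝟏 (series s) x) (series-step s x))
            (Span-+ series states (Span-fin series states (0 , initial-supp s))
              (Span-∑ series states columns _ λ c → Span-gen series states (letter c) (letter-pos c) (complete (step s c))))
      in Q , unit , λ s → fin s (complete s)
      where
      𝟏 : Op (suc m)
      𝟏 = mono 1ℤ 𝟎
      act-𝟏 : ∀ f x → act 𝟏 f x ≡ f x
      act-𝟏 f x = trans (ℤ.*-identityˡ (f (x ⊕ 𝟎))) (cong f (⊕-𝟎 x))
      unit-𝟏 : Unit 𝟏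
      unit-𝟏 f N v n γ n≤N = act-𝟏 f (n ∷ γ)

    count-recurrence : ∀ s → ∃ λ D → Σ (ℕ → ℕ → ℤ) λ r →
      (∃ λ i → ∃ λ j → i ℕ.< D × j ℕ.< D × r i j ≢ 0ℤ) ×
      (∀ N → ∑ (upTo D) (λ i → ∑ (upTo D) (λ j →
         r i j * ((N + - ℤ.+ (2 ℕ.* D)) ℤ.^ j * series s (N + - ℤ.+ (2 ℕ.* i) ∷ 𝟎)))) ≡ 0ℤ)
    count-recurrence s =
      let Q , unit , fin = series-rational
          ρ , supp = fin s
          D , large = radius-small (reach Q) m ρ
      in D , diagonal-recurrence (series s) Q unit ρ supp (λ { ℤ.-[1+ _ ] γ _ → refl ; (ℤ.+ _) γ (ℤ.+<+ ()) }) D large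

-- Recognising patterns in rows

prefixᵇ : Word → Word → Bool
prefixᵇ [] w = true
prefixᵇ (b ∷ p) [] = false
prefixᵇ (b ∷ p) (a ∷ w) = does (a Bool.≟ b) ∧ prefixᵇ p w

mutual
  containsᵇ properly-containsᵇ : Word → Word → Bool
  containsᵇ w p = prefixᵇ p w ∨ properly-containsᵇ w p
  properly-containsᵇ [] p = false
  properly-containsᵇ (a ∷ w) p = containsᵇ w p

IsPrefix⇒ : ∀ {p w} → IsPrefix p w → prefixᵇ p w ≡ true
IsPrefix⇒ []-prefix = refl
IsPrefix⇒ (∷-prefix {a} q) with a Bool.≟ a
... | yes _ = IsPrefix⇒ q
... | no a≢a = contradiction refl a≢a

IsPrefix⇐ : ∀ p w → prefixᵇ p w ≡ true → IsPrefix p w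
IsPrefix⇐ [] w e = []-prefix
IsPrefix⇐ (b ∷ p) (a ∷ w) e with a Bool.≟ b
... | yes refl = ∷-prefix (IsPrefix⇐ p w e)

Contains⇒ : ∀ {w p} → Contains w p → containsᵇ w p ≡ true
Contains⇒ {w} {p} (here q) = cong (_∨ properly-containsᵇ w p) (IsPrefix⇒ q)
Contains⇒ {a ∷ w} {p} (there c) =
  trans (cong (prefixᵇ p (a ∷ w) ∨_) (Contains⇒ c)) (Bool.∨-zeroʳ (prefixᵇ p (a ∷ w)))

Contains⇐ : ∀ w p → containsᵇ w p ≡ true → Contains w p
Contains⇐ w p e with prefixᵇ p w in eq
... | true = here (IsPrefix⇐ p w eq)
Contains⇐ (a ∷ w) p e | false = there (Contains⇐ w p e)

contains? : ∀ w p → Dec (Contains w p)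
contains? w p = map′ (Contains⇐ w p) Contains⇒ (containsᵇ w p Bool.≟ true)

-- A bit for every suffix q of p, the empty one included, from p down to []:
-- it is set when the part of p before q has just been read.  The bit of []
-- stays set once p has been found.
Bits : Word → Set
Bits p = Vec Bool (suc (length p))

found : ∀ p → Bits p → Bool
found [] (x ∷ []) = x
found (b ∷ p) (x ∷ v) = found p v

-- `y` is the bit handed down from the next longer suffix. For the whole pattern it is set to `true`
-- in every run, because a match may start at any position. At `[]` the old bit is kept, which makes
-- success permanent.
next : ∀ p → Bool → Bits p → Bool → Bits p
next [] y (x ∷ []) a = (y ∨ x) ∷ []
next (b ∷ p) y (x ∷ v) a = y ∷ next p (x ∧ does (a Bool.≟ b)) v a

start : ∀ p → Bits p
start p = true ∷ replicate (length p) false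

-- Whether a partial match recorded in `v` is completed by a prefix of the unread `w`, or a match
-- was already found.
pending : ∀ p → Bits p → Word → Bool
pending [] (x ∷ []) w = x
pending (b ∷ p) (x ∷ v) w = (x ∧ prefixᵇ (b ∷ p) w) ∨ pending p v w

pending-[] : ∀ p v → pending p v [] ≡ found p v
pending-[] [] (x ∷ []) = refl
pending-[] (b ∷ p) (x ∷ v) = trans (cong (_∨ pending p v []) (Bool.∧-zeroʳ x)) (pending-[] p v)

pending-next : ∀ p y v a w → pending p (next p y v a) w ≡ (y ∧ prefixᵇ p w) ∨ pending p v (a ∷ w)
pending-next [] y (x ∷ []) a w = cong (_∨ x) (sym (Bool.∧-identityʳ y))
pending-next (b ∷ p) y (x ∷ v) a w = cong ((y ∧ prefixᵇ (b ∷ p) w) ∨_)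
  (trans (pending-next p (x ∧ does (a Bool.≟ b)) v a w)
         (cong (_∨ pending p v (a ∷ w)) (Bool.∧-assoc x (does (a Bool.≟ b)) (prefixᵇ p w))))

-- Matches starting at the current position are represented by the bits of `v`; only later starts
-- remain, hence `properly-containsᵇ` instead of `containsᵇ`.
found-foldl : ∀ p v w → found p (foldl (next p true) v w) ≡ pending p v w ∨ properly-containsᵇ w p
found-foldl p v [] = sym (trans (Bool.∨-identityʳ (pending p v [])) (pending-[] p v))
found-foldl p v (a ∷ w) =
  trans (found-foldl p (next p true v a) w)
  (trans (cong (_∨ properly-containsᵇ w p)
           (trans (pending-next p true v a w) (Bool.∨-comm (prefixᵇ p w) (pending p v (a ∷ w)))))
         (Bool.∨-assoc (pending p v (a ∷ w)) (prefixᵇ p w) (properly-containsᵇ w p)))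

found-start : ∀ p w → found p (foldl (next p true) (start p) w) ≡ containsᵇ w p
found-start p w = trans (found-foldl p (start p) w) (cong (_∨ properly-containsᵇ w p) (pending-start p))
  where
  pending-none : ∀ p → pending p (replicate _ false) w ≡ false
  pending-none [] = refl
  pending-none (b ∷ p) = pending-none p
  pending-start : ∀ p → pending p (start p) w ≡ prefixᵇ p w
  pending-start [] = refl
  pending-start (b ∷ p) = trans (cong (prefixᵇ (b ∷ p) w ∨_) (pending-none p)) (Bool.∨-identityʳ _)

RowState : List Word → Set
RowState [] = ⊤
RowState (p ∷ H) = Bits p × RowState H

row-start : ∀ H → RowState H
row-start [] = tt
row-start (p ∷ H) = start p , row-start H

row-step : ∀ H → RowState H → Bool → RowState H
row-step [] _ a = tt
row-step (p ∷ H) (v , s) a = next p true v a , row-step H s a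

row-accept : ∀ H → RowState H → Bool
row-accept [] _ = true
row-accept (p ∷ H) (v , s) = not (found p v) ∧ row-accept H s

row-run : ∀ p H v s w → foldl (row-step (p ∷ H)) (v , s) w ≡ (foldl (next p true) v w , foldl (row-step H) s w)
row-run p H v s [] = refl
row-run p H v s (a ∷ w) = row-run p H (next p true v a) (row-step H s a) w

∧-true : ∀ {x y} → x ∧ y ≡ true ⇔ (x ≡ true × y ≡ true)
∧-true {true} = mk⇔ (refl ,_) proj₂
∧-true {false} = mk⇔ (λ ()) (λ { (() , _) })

row-correct : ∀ H w → row-accept H (foldl (row-step H) (row-start H) w) ≡ true ⇔ All (Avoids w) H
row-correct [] w = mk⇔ (λ _ → []) (λ _ → refl)
row-correct (p ∷ H) w rewrite row-run p H (start p) (row-start H) w | found-start p w =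
  ⇔-trans ∧-true (⇔-trans (avoids ×-⇔ row-correct H w)
    (mk⇔ (λ (a , as) → a ∷ as) (λ { (a ∷ as) → a , as })))
  where
  avoids : not (containsᵇ w p) ≡ true ⇔ Avoids w p
  avoids with containsᵇ w p in eq
  ... | true = mk⇔ (λ ()) (λ av → contradiction (Contains⇐ w p eq) av)
  ... | false = mk⇔ (λ _ c → contradiction (trans (sym eq) (Contains⇒ c)) λ ()) (λ _ → refl)

bools : List Bool
bools = true ∷ false ∷ []

∈-bools : ∀ b → b ∈ bools
∈-bools true = here refl
∈-bools false = there (here refl)

bools-unique : Unique bools
bools-unique = ((λ ()) ∷ []) ∷ ([] ∷ [])

∈-vecs-complete : {xs : List A} → (∀ x → x ∈ xs) → (v : Vec A n) → v ∈ vecs xs n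
∈-vecs-complete ∈xs v = ∈-vecs (V.universal ∈xs v)

row-states : ∀ H → List (RowState H)
row-states [] = tt ∷ []
row-states (p ∷ H) = cartesianProductWith _,_ (vecs bools (suc (length p))) (row-states H)

∈-row-states : ∀ H s → s ∈ row-states H
∈-row-states [] tt = here refl
∈-row-states (p ∷ H) (v , s) = ∈-cartesianProductWith⁺ _,_ (∈-vecs-complete ∈-bools v) (∈-row-states H s)

-- Balances, transposition and acceptance row by row

balance : Word → ℤ
balance [] = 0ℤ
balance (a ∷ w) = sign a + balance w

balance-ones : ∀ w → balance w + (ℤ.+ ones w + ℤ.+ ones w) ≡ ℤ.+ length w
balance-ones [] = refl
balance-ones (true ∷ w) = trans (shift (balance w) (ℤ.+ ones w)) (cong (1ℤ +_) (balance-ones w))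
  where
  shift : ∀ b o → ℤ.-1ℤ + b + ((1ℤ + o) + (1ℤ + o)) ≡ 1ℤ + (b + (o + o))
  shift = solve-∀
balance-ones (false ∷ w) =
  trans (ℤ.+-assoc 1ℤ (balance w) (ℤ.+ ones w + ℤ.+ ones w)) (cong (1ℤ +_) (balance-ones w))

balanced : ∀ n w → length w ≡ 2 ℕ.* n → balance w ≡ 0ℤ ⇔ ones w ≡ n
balanced n w len = mk⇔ forth back
  where
  double : ∀ k → 2 ℕ.* k ≡ k ℕ.+ k
  double k = cong (k ℕ.+_) (ℕ.+-identityʳ k)
  forth : balance w ≡ 0ℤ → ones w ≡ n
  forth e = ℕ.*-cancelˡ-≡ (ones w) n 2 (trans (double (ones w)) (trans (ℤ.+-injective
    (trans (sym (ℤ.+-identityˡ _)) (trans (cong (_+ (ℤ.+ ones w + ℤ.+ ones w)) (sym e)) (balance-ones w)))) len))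
  back : ones w ≡ n → balance w ≡ 0ℤ
  back e = trans (solve-for (balance w) (ℤ.+ ones w + ℤ.+ ones w) (ℤ.+ length w) (balance-ones w))
    (trans (cong (λ k → ℤ.+ k + - (ℤ.+ ones w + ℤ.+ ones w)) (trans len (trans (cong (2 ℕ.*_) (sym e)) (double (ones w)))))
           (ℤ.+-inverseʳ (ℤ.+ (ones w ℕ.+ ones w))))
    where
    solve-for : ∀ b o l → b + o ≡ l → b ≡ l + - o
    solve-for b o l refl = cancel b o
      where
      cancel : ∀ b o → b ≡ b + o + - o
      cancel = solve-∀

-- The argument on the left is what `transpose` itself unfolds to: `M` with the column `c` put in
-- front.
transpose-∷ : (c : Vec A m) (M : Vec (Vec A n) m) →
  transpose ((replicate m _∷_ ⊛ c) ⊛ M) ≡ c ∷ transpose M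
transpose-∷ [] [] = refl
transpose-∷ (x ∷ c) (r ∷ M) = cong ((replicate _ _∷_ ⊛ (x ∷ r)) ⊛_) (transpose-∷ c M)

transpose-involutive : (M : Vec (Vec A n) m) → transpose (transpose M) ≡ M
transpose-involutive {n = n} [] = empty (transpose (replicate n []))
  where
  empty : (v : Vec A 0) → v ≡ []
  empty [] = refl
transpose-involutive (r ∷ M) = trans (transpose-∷ r (transpose M)) (cong (r ∷_) (transpose-involutive M))

module Rows {S : Set} (step : S → Bool → S) (accept : S → Bool) where

  steps : Vec S m → Column m → Vec S m
  steps = zipWith step

  accept-all : Vec S m → Bool
  accept-all [] = true
  accept-all (s ∷ σ) = accept s ∧ accept-all σ

  RowAccepts : S → ℤ → Vec Bool n → Set
  RowAccepts s y [] = accept s ≡ true × y ≡ 0ℤ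
  RowAccepts s y (a ∷ r) = RowAccepts (step s a) (y + sign a) r

  RowsAccept : Vec S m → Point m → Vec (Vec Bool n) m → Set
  RowsAccept [] [] [] = ⊤
  RowsAccept (s ∷ σ) (y ∷ γ) (r ∷ M) = RowAccepts s y r × RowsAccept σ γ M

  RowsAccept-∷ : (σ : Vec S m) (γ : Point m) (c : Column m) (M : Vec (Vec Bool n) m) →
    RowsAccept σ γ ((replicate m _∷_ ⊛ c) ⊛ M) ≡ RowsAccept (steps σ c) (γ ⊕ signs c) M
  RowsAccept-∷ [] [] [] [] = refl
  RowsAccept-∷ (s ∷ σ) (y ∷ γ) (a ∷ c) (r ∷ M) = cong (RowAccepts (step s a) (y + sign a) r ×_) (RowsAccept-∷ σ γ c M)

  RowsAccept-[] : (σ : Vec S m) (γ : Point m) → RowsAccept σ γ (replicate m []) ⇔ (accept-all σ ≡ true × γ ≡ 𝟎)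
  RowsAccept-[] [] [] = mk⇔ (λ _ → refl , refl) (λ _ → tt)
  RowsAccept-[] (s ∷ σ) (y ∷ γ) = mk⇔
    (λ ((p , q) , rest) → let p′ , q′ = to (RowsAccept-[] σ γ) rest in from ∧-true (p , p′) , cong₂ _∷_ q q′)
    (λ { (p , refl) → let p , p′ = to ∧-true p in (p , refl) , from (RowsAccept-[] σ 𝟎) (p′ , refl) })

  module _ (columns : List (Column m)) where
    open Automaton steps accept-all columns

    accepts-transpose : ∀ σ γ (cs : Vec (Column m) n) → Accepts σ γ cs ⇔ RowsAccept σ γ (transpose cs)
    accepts-transpose σ γ [] = ⇔-sym (RowsAccept-[] σ γ)
    accepts-transpose σ γ (c ∷ cs) =
      subst (Accepts (steps σ c) (γ ⊕ signs c) cs ⇔_) (sym (RowsAccept-∷ σ γ c (transpose cs)))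
            (accepts-transpose (steps σ c) (γ ⊕ signs c) cs)

  RowAccepts-⇔ : ∀ s y (r : Vec Bool n) →
    RowAccepts s y r ⇔ (accept (foldl step s (toList r)) ≡ true × y + balance (toList r) ≡ 0ℤ)
  RowAccepts-⇔ s y [] = subst (λ z → (accept s ≡ true × y ≡ 0ℤ) ⇔ (accept s ≡ true × z ≡ 0ℤ)) (sym (ℤ.+-identityʳ y)) ⇔-refl
  RowAccepts-⇔ s y (a ∷ r) =
    subst (λ z → RowAccepts (step s a) (y + sign a) r ⇔ (accept (foldl step (step s a) (toList r)) ≡ true × z ≡ 0ℤ))
      (ℤ.+-assoc y (sign a) (balance (toList r))) (RowAccepts-⇔ (step s a) (y + sign a) r)

-- Good matrices as accepted words

count-unique : {P : A → Set} {b : ℕ} → IsCount P b → {ys : List A} → Unique ys → (∀ y → y ∈ ys ⇔ P y) → b ≡ length ys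
count-unique (xs , u , complete , sound , refl) u′ ∈ys⇔ =
  -- Duplicate-free lists with the same members are permutations of each other.
  ↭-length (∼bag⇒↭ (unique∧set⇒bag u u′ (λ {x} →
    mk⇔ (λ x∈ → from (∈ys⇔ x) (All.lookup sound x∈)) (λ x∈ → complete x (to (∈ys⇔ x) x∈)))))

All-toList : {P : Word → Set} (M : Matrix m n) → All P (rows M) ⇔ V.All (P ∘ toList) M
All-toList [] = mk⇔ (λ _ → V.[]) (λ _ → [])
All-toList (r ∷ M) = mk⇔ (λ { (p ∷ ps) → p V.∷ to (All-toList M) ps }) (λ { (p V.∷ ps) → p ∷ from (All-toList M) ps })

∈-vecs⁻ : (xs : List A) {v : Vec A n} → v ∈ vecs xs n → V.All (_∈ xs) v
∈-vecs⁻ xs {[]} _ = V.[]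
∈-vecs⁻ {n = suc n} xs {v} v∈ with ∈-cartesianProductWith⁻ _∷_ xs (vecs xs n) v∈
... | x , w , x∈ , w∈ , refl = x∈ V.∷ ∈-vecs⁻ xs w∈

module GoodMatrices (H V : List Word) (k : ℕ) where

  private
    width = 2 ℕ.* k

  Valid : Column width → Set
  Valid c = ones (toList c) ≡ k × All (Avoids (toList c)) V

  valid? : Decidable Valid
  valid? c = (ones (toList c) ℕ.≟ k) ×-dec all? (λ p → ¬? (contains? (toList c) p)) V

  columns : List (Column width)
  columns = filter valid? (vecs bools width)

  ∈-columns : ∀ c → c ∈ columns ⇔ Valid c
  ∈-columns c = mk⇔ (λ c∈ → proj₂ (∈-filter⁻ valid? {xs = vecs bools width} c∈))
                    (λ v → ∈-filter⁺ valid? (∈-vecs-complete ∈-bools c) v)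

  open Rows (row-step H) (row-accept H)
  open Automaton steps accept-all columns public

  states : List (Vec (RowState H) width)
  states = vecs (row-states H) width

  σ₀ : Vec (RowState H) width
  σ₀ = replicate width (row-start H)

  ∈-states : ∀ σ → σ ∈ states
  ∈-states = ∈-vecs-complete (∈-row-states H)

  rows-good : ∀ n {m} (M : Matrix m (2 ℕ.* n)) →
    RowsAccept (replicate m (row-start H)) 𝟎 M ⇔ V.All (λ r → ones (toList r) ≡ n × All (Avoids (toList r)) H) M
  rows-good n [] = mk⇔ (λ _ → V.[]) (λ _ → tt)
  rows-good n (r ∷ M) =
    ⇔-trans (row ×-⇔ rows-good n M) (mk⇔ (λ (p , ps) → p V.∷ ps) (λ { (p V.∷ ps) → p , ps }))
    where
    row : RowAccepts (row-start H) 0ℤ r ⇔ (ones (toList r) ≡ n × All (Avoids (toList r)) H)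
    row = ⇔-trans (RowAccepts-⇔ (row-start H) 0ℤ r)
      (⇔-trans (row-correct H (toList r) ×-⇔
                subst (λ z → z ≡ 0ℤ ⇔ ones (toList r) ≡ n) (sym (ℤ.+-identityˡ _))
                  (balanced n (toList r) (Vec.length-toList r)))
               (mk⇔ Product.swap Product.swap))

  matrices : ∀ n → List (Matrix width (2 ℕ.* n))
  matrices n = map transpose (filter (accepts? σ₀ 𝟎) (vecs columns (2 ℕ.* n)))

  matrices-unique : ∀ n → Unique (matrices n)
  matrices-unique n = map⁺ transpose-injective
    (filter⁺ (accepts? σ₀ 𝟎) (vecs-unique (filter⁺ valid? (vecs-unique bools-unique width)) (2 ℕ.* n)))
    where
    transpose-injective : ∀ {M N : Matrix (2 ℕ.* n) width} → transpose M ≡ transpose N → M ≡ N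
    transpose-injective {M} {N} e =
      trans (sym (transpose-involutive M)) (trans (cong transpose e) (transpose-involutive N))

  ∈-matrices : ∀ n M → M ∈ matrices n ⇔ Good H V k n M
  ∈-matrices n M = mk⇔ sound complete
    where
    words = vecs columns (2 ℕ.* n)
    sound : M ∈ matrices n → Good H V k n M
    sound M∈ with ∈-map⁻ transpose M∈
    ... | cs , cs∈ , refl =
      let cs∈words , acc = ∈-filter⁻ (accepts? σ₀ 𝟎) {xs = words} cs∈
          rs = to (rows-good n (transpose cs)) (to (accepts-transpose columns σ₀ 𝟎 cs) acc)
          vs = V.map (to (∈-columns _)) (∈-vecs⁻ columns cs∈words)
          vs′ = subst (V.All Valid) (sym (transpose-involutive cs)) vs
      in from (All-toList (transpose cs)) (V.map proj₁ rs) ,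
         from (All-toList (transpose (transpose cs))) (V.map proj₁ vs′) ,
         from (All-toList (transpose cs)) (V.map proj₂ rs) ,
         from (All-toList (transpose (transpose cs))) (V.map proj₂ vs′)
    complete : Good H V k n M → M ∈ matrices n
    complete (r₁ , c₁ , r₂ , c₂) = subst (_∈ matrices n) (transpose-involutive M)
      (∈-map⁺ transpose (∈-filter⁺ (accepts? σ₀ 𝟎)
        (∈-vecs (V.map (from (∈-columns _)) (V.zip (to (All-toList (transpose M)) c₁ , to (All-toList (transpose M)) c₂))))
        (from (accepts-transpose columns σ₀ 𝟎 (transpose M))
          (subst (RowsAccept σ₀ 𝟎) (sym (transpose-involutive M))
            (from (rows-good n M) (V.zip (to (All-toList M) r₁ , to (All-toList M) r₂)))))))

  count-good : ∀ n {b} → IsCount (Good H V k n) b → count σ₀ (2 ℕ.* n) 𝟎 ≡ ℤ.+ b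
  count-good n isCount = trans (count-≡ σ₀ (2 ℕ.* n) 𝟎) (cong (λ c → ℤ.+ c)
    (trans (sym (length-map transpose (filter (accepts? σ₀ 𝟎) (vecs columns (2 ℕ.* n)))))
           (sym (count-unique isCount (matrices-unique n) (∈-matrices n)))))

-- From a backward to a forward recurrence

∑-upTo-suc : ∀ n (g : ℕ → ℤ) → ∑ (upTo (suc n)) g ≡ g 0 + ∑ (upTo n) (g ∘ suc)
∑-upTo-suc n g = cong (g 0 +_)
  (trans (cong (λ xs → ∑ xs g) (sym (map-applyUpTo (λ i → i) suc n))) (∑-map suc (upTo n) g))

-- Coefficients of `u * ∑ s j * (2 * x)^j`, as the weight is `2n` and not `n`; `u` accumulates the
-- powers of two.
doubled : ℤ → (ℕ → ℤ) → ℕ → Poly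
doubled u s zero = []
doubled u s (suc D) = u * s 0 ∷ doubled (u * ℤ.+ 2) (s ∘ suc) D

eval-doubled : ∀ u s D x → evalPoly (doubled u s D) x ≡ u * ∑ (upTo D) (λ j → s j * (ℤ.+ 2 * x) ℤ.^ j)
eval-doubled u s zero x = sym (ℤ.*-zeroʳ u)
eval-doubled u s (suc D) x = begin
  u * s 0 + x * evalPoly (doubled (u * ℤ.+ 2) (s ∘ suc) D) x
    ≡⟨ cong (λ y → u * s 0 + x * y) (eval-doubled (u * ℤ.+ 2) (s ∘ suc) D x) ⟩
  u * s 0 + x * (u * ℤ.+ 2 * ∑ (upTo D) (λ j → s (suc j) * z ℤ.^ j))
    ≡⟨ collect u (s 0) x (∑ (upTo D) (λ j → s (suc j) * z ℤ.^ j)) ⟩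
  u * (s 0 * 1ℤ + z * ∑ (upTo D) (λ j → s (suc j) * z ℤ.^ j))
    ≡⟨ cong (λ y → u * (s 0 * 1ℤ + y)) (trans (∑-*ˡ z (upTo D) _)
         (∑-cong (upTo D) λ j _ → swap z (s (suc j)) (z ℤ.^ j))) ⟩
  u * (s 0 * 1ℤ + ∑ (upTo D) (λ j → s (suc j) * z ℤ.^ suc j))
    ≡⟨ cong (u *_) (sym (∑-upTo-suc D (λ j → s j * z ℤ.^ j))) ⟩
  u * ∑ (upTo (suc D)) (λ j → s j * z ℤ.^ j) ∎
  where
  open ≡-Reasoning
  z = ℤ.+ 2 * x
  collect : ∀ u a x y → u * a + x * (u * ℤ.+ 2 * y) ≡ u * (a * 1ℤ + ℤ.+ 2 * x * y)
  collect = solve-∀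
  swap : ∀ z a y → z * (a * y) ≡ a * (z * y)
  swap = solve-∀

doubled-nonzero : ∀ u s {D j} → u ≢ 0ℤ → j ℕ.< D → s j ≢ 0ℤ → NonZeroPoly (doubled u s D)
doubled-nonzero u s {suc D} {zero} u≢0 _ sj≢0 (e ∷ _) = *-nonzero u≢0 sj≢0 e
doubled-nonzero u s {suc D} {suc j} u≢0 (ℕ.s≤s j<D) sj≢0 (_ ∷ es) =
  doubled-nonzero (u * ℤ.+ 2) (s ∘ suc) (*-nonzero u≢0 (λ ())) j<D sj≢0 es

module _ (p : ℕ → Poly) (b : ℕ → ℕ) (n : ℕ) where

  private
    term : ℕ → ℤ
    term l = evalPoly (p l) (ℤ.+ n) * ℤ.+ b (n ℕ.+ l)

  recSum-∑ : ∀ L → recSum L p b n ≡ evalPoly (p 0) (ℤ.+ n) * ℤ.+ b n + ∑ (upTo L) (λ i → term (L ℕ.∸ i))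
  recSum-∑ zero = sym (ℤ.+-identityʳ _)
  recSum-∑ (suc L) = begin
    recSum L p b n + term (suc L)
      ≡⟨ cong (_+ term (suc L)) (recSum-∑ L) ⟩
    t₀ + ∑ (upTo L) (λ i → term (L ℕ.∸ i)) + term (suc L)
      ≡⟨ swap t₀ (∑ (upTo L) (λ i → term (L ℕ.∸ i))) (term (suc L)) ⟩
    t₀ + (term (suc L) + ∑ (upTo L) (λ i → term (L ℕ.∸ i)))
      ≡⟨ cong (t₀ +_) (sym (∑-upTo-suc L (λ i → term (suc L ℕ.∸ i)))) ⟩
    t₀ + ∑ (upTo (suc L)) (λ i → term (suc L ℕ.∸ i)) ∎
    where
    open ≡-Reasoning
    t₀ = evalPoly (p 0) (ℤ.+ n) * ℤ.+ b n
    swap : ∀ a b c → a + b + c ≡ a + (c + b)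
    swap = solve-∀

  -- Serves to end the recurrence at a nonzero leading polynomial.
  recSum-truncate : ∀ L {M} → L ℕ.≤ M → (∀ l → L ℕ.< l → l ℕ.≤ M → evalPoly (p l) (ℤ.+ n) ≡ 0ℤ) →
    recSum L p b n ≡ recSum M p b n
  recSum-truncate L L≤M zeros = go (ℕ.≤⇒≤′ L≤M) zeros
    where
    go : ∀ {M} → L ℕ.≤′ M → (∀ l → L ℕ.< l → l ℕ.≤ M → evalPoly (p l) (ℤ.+ n) ≡ 0ℤ) → recSum L p b n ≡ recSum M p b n
    go ℕ.≤′-refl zeros = refl
    go (ℕ.≤′-step {n = M} L≤M) zeros = trans (go L≤M λ l L<l l≤M → zeros l L<l (ℕ.m≤n⇒m≤1+n l≤M))
      (sym (trans (cong (λ y → recSum M p b n + y * ℤ.+ b (n ℕ.+ suc M)) (zeros (suc M) (ℕ.s≤s (ℕ.≤′⇒≤ L≤M)) ℕ.≤-refl))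
                  (ℤ.+-identityʳ _)))

-- Reading i ↦ D - i turns the backward recurrence for F(N - 2i) at N = 2(n + D)
-- into a forward one for b(n + l).
assemble : (F : ℤ → ℤ) (b : ℕ → ℕ) → (∀ n → F (ℤ.+ (2 ℕ.* suc n)) ≡ ℤ.+ b (suc n)) →
  (∃ λ D → Σ (ℕ → ℕ → ℤ) λ r →
    (∃ λ i → ∃ λ j → i ℕ.< D × j ℕ.< D × r i j ≢ 0ℤ) ×
    (∀ N → ∑ (upTo D) (λ i → ∑ (upTo D) (λ j →
       r i j * ((N + - ℤ.+ (2 ℕ.* D)) ℤ.^ j * F (N + - ℤ.+ (2 ℕ.* i))))) ≡ 0ℤ)) →
  Σ ℕ λ L → Σ (ℕ → Poly) λ p → NonZeroPoly (p (suc L)) × (∀ n → recSum (suc L) p b (suc n) ≡ 0ℤ)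
assemble F b F≡b (D , r , (i , j , i<D , j<D , rij≢0) , relation)
  -- Reversal makes the least `i` with a nonzero coefficient the largest index `D - i` with a
  -- nonzero polynomial.
  with least (λ i → any? (λ j → ¬? (r i j ℤ.≟ 0ℤ)) (upTo D)) i (lose (∈-upTo⁺ j<D) rij≢0)
... | i₀ , i₀≤i , some , below with ℕ.m≤n⇒∃[o]m+o≡n (ℕ.≤-<-trans i₀≤i i<D)
... | L , refl = L , p , nonzero , holds
  where
  p : ℕ → Poly
  -- Since `i < D`, the index `D - i` is never `0`.
  p zero = []
  p l@(suc _) = doubled 1ℤ (r (D ℕ.∸ l)) D

  complement : D ℕ.∸ suc L ≡ i₀
  complement = trans (cong (ℕ._∸ suc L) (sym (ℕ.+-suc i₀ L))) (ℕ.m+n∸n≡m i₀ (suc L))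

  nonzero : NonZeroPoly (p (suc L))
  nonzero with find some
  ... | j , j∈ , r≢0 = doubled-nonzero 1ℤ (r (D ℕ.∸ suc L)) (λ ()) (∈-upTo⁻ j∈)
    (subst (λ i → r i j ≢ 0ℤ) (sym complement) r≢0)

  eval-p : ∀ n i → i ℕ.< D → evalPoly (p (D ℕ.∸ i)) (ℤ.+ n) ≡ ∑ (upTo D) (λ j → r i j * (ℤ.+ 2 * ℤ.+ n) ℤ.^ j)
  eval-p n i i<D with D ℕ.∸ i in eq
  ... | zero = contradiction (ℕ.m∸n≡0⇒m≤n eq) (ℕ.<⇒≱ i<D)
  ... | suc l = trans (cong (λ i → evalPoly (doubled 1ℤ (r i) D) (ℤ.+ n))
                        (trans (cong (D ℕ.∸_) (sym eq)) (ℕ.m∸[m∸n]≡n (ℕ.<⇒≤ i<D))))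
                  (trans (eval-doubled 1ℤ (r i) D (ℤ.+ n)) (ℤ.*-identityˡ _))

  zeros : ∀ n l → suc L ℕ.< l → l ℕ.≤ D → evalPoly (p l) (ℤ.+ n) ≡ 0ℤ
  zeros n l L<l l≤D =
    trans (cong (λ l → evalPoly (p l) (ℤ.+ n)) (sym (ℕ.m∸[m∸n]≡n l≤D)))
    (trans (eval-p n (D ℕ.∸ l) (ℕ.<-≤-trans i<i₀ (ℕ.≤-trans (ℕ.m≤m+n i₀ L) (ℕ.n≤1+n _))))
           (∑-zero (upTo D) λ j j∈ → cong (_* (ℤ.+ 2 * ℤ.+ n) ℤ.^ j) (r≡0 j j∈)))
    where
    i<i₀ : D ℕ.∸ l ℕ.< i₀
    i<i₀ = subst (D ℕ.∸ l ℕ.<_) complement (ℕ.∸-monoʳ-< L<l l≤D)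
    r≡0 : ∀ j → j ∈ upTo D → r (D ℕ.∸ l) j ≡ 0ℤ
    r≡0 j j∈ with r (D ℕ.∸ l) j ℤ.≟ 0ℤ
    ... | yes e = e
    ... | no ¬e = contradiction (lose j∈ ¬e) (below i<i₀)

  holds : ∀ n → recSum (suc L) p b (suc n) ≡ 0ℤ
  holds n = begin
    recSum (suc L) p b (suc n)
      ≡⟨ recSum-truncate p b (suc n) (suc L) (ℕ.s≤s (ℕ.m≤n+m L i₀)) (zeros (suc n)) ⟩
    recSum D p b (suc n)
      ≡⟨ trans (recSum-∑ p b (suc n) D) (ℤ.+-identityˡ _) ⟩
    ∑ (upTo D) (λ i → evalPoly (p (D ℕ.∸ i)) (ℤ.+ suc n) * ℤ.+ b (suc n ℕ.+ (D ℕ.∸ i)))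
      ≡⟨ ∑-cong (upTo D) (λ i i∈ → row i (∈-upTo⁻ i∈)) ⟩
    ∑ (upTo D) (λ i → ∑ (upTo D) (λ j → r i j * ((N + - ℤ.+ (2 ℕ.* D)) ℤ.^ j * F (N + - ℤ.+ (2 ℕ.* i)))))
      ≡⟨ relation N ⟩
    0ℤ ∎
    where
    open ≡-Reasoning
    N = ℤ.+ (2 ℕ.* (suc n ℕ.+ D))
    2* : ∀ k → ℤ.+ (2 ℕ.* k) ≡ ℤ.+ 2 * ℤ.+ k
    2* k = ℤ.pos-* 2 k
    difference : ∀ a d → ℤ.+ 2 * (a + d) + - (ℤ.+ 2 * d) ≡ ℤ.+ 2 * a
    difference = solve-∀
    drop : ∀ a d → ℤ.+ (2 ℕ.* (a ℕ.+ d)) + - ℤ.+ (2 ℕ.* d) ≡ ℤ.+ (2 ℕ.* a)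
    drop a d = trans (cong₂ (λ x y → x + - y) (2* (a ℕ.+ d)) (2* d)) (trans (difference (ℤ.+ a) (ℤ.+ d)) (sym (2* a)))
    weight : N + - ℤ.+ (2 ℕ.* D) ≡ ℤ.+ 2 * ℤ.+ suc n
    weight = trans (drop (suc n) D) (2* (suc n))
    value : ∀ i → i ℕ.< D → F (N + - ℤ.+ (2 ℕ.* i)) ≡ ℤ.+ b (suc n ℕ.+ (D ℕ.∸ i))
    value i i<D = trans (cong F (trans (cong (λ k → ℤ.+ (2 ℕ.* k) + - ℤ.+ (2 ℕ.* i))
      (trans (cong (suc n ℕ.+_) (sym (ℕ.m∸n+n≡m (ℕ.<⇒≤ i<D)))) (sym (ℕ.+-assoc (suc n) (D ℕ.∸ i) i))))
      (drop (suc n ℕ.+ (D ℕ.∸ i)) i))) (F≡b (n ℕ.+ (D ℕ.∸ i)))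
    row : ∀ i → i ℕ.< D → evalPoly (p (D ℕ.∸ i)) (ℤ.+ suc n) * ℤ.+ b (suc n ℕ.+ (D ℕ.∸ i)) ≡
      ∑ (upTo D) (λ j → r i j * ((N + - ℤ.+ (2 ℕ.* D)) ℤ.^ j * F (N + - ℤ.+ (2 ℕ.* i))))
    row i i<D = trans (cong (_* bᵢ) (eval-p (suc n) i i<D))
      (trans (ℤ.*-comm _ bᵢ) (trans (∑-*ˡ bᵢ (upTo D) _) (∑-cong (upTo D) λ j _ →
        trans (swap bᵢ (r i j) ((ℤ.+ 2 * ℤ.+ suc n) ℤ.^ j))
              (cong₂ (λ w y → r i j * (w ℤ.^ j * y)) (sym weight) (sym (value i i<D))))))
      where
      bᵢ = ℤ.+ b (suc n ℕ.+ (D ℕ.∸ i))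
      swap : ∀ b r w → b * (r * w) ≡ r * (w * b)
      swap = solve-∀

theorem3 : (k : ℕ) → (H V : List Word) → (b : ℕ → ℕ) →
    (∀ n → IsCount (Good H V (suc k) (suc n)) (b (suc n))) →
    Σ ℕ λ L → Σ (ℕ → Poly) λ p →
    NonZeroPoly (p (suc L)) ×
    (∀ n → recSum (suc L) p b (suc n) ≡ 0ℤ)
theorem3 k H V b isCount =
  assemble (λ N → series σ₀ (N ∷ 𝟎)) b (λ n → count-good (suc n) (isCount n)) (count-recurrence states ∈-states σ₀)
  where open GoodMatrices H V (suc k)
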